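{- Let $t$ be a closed term, let $\pi$ be a derivation of $\vdash t:L$ with $L$ a ground type, and let $\mathcal B_t$ be the Bayesian network associated with $\pi$. Then $$[\![\pi]\!]=\sum_{\mathrm{Nm}(\pi)-\mathrm{Nm}(L)}[\![\mathcal B_t]\!].$$
   Context: **Terms.** Terms $t,u$ and values $v,w$ (up to $\alpha$-equivalence): $t,u ::= v \mid \mathsf{sample}_d \mid \mathsf{case}\ v\ \mathsf{of}\ \{v_i\Rightarrow \mathsf{sample}_{d_i}\} \mid \mathsf{obs}(x=b) \mid \mathsf{let}\ x=u\ \mathsf{in}\ t \mid \mathsf{letp}\ \langle x,y\rangle=v\ \mathsf{in}\ t \mid t\,v\mid \lambda x.t\mid \mathsf{der}\,v$; $v,w ::= x \mid \langle v,w\rangle \mid\ !t \mid b$; $b::=\mathtt t\mid\mathtt f$; $d$ ranges over probability distributions on $\{\mathtt t,\mathtt f\}$. $\mathsf c\langle y_1,\dots,y_n\rangle$ abbreviates $\mathsf{case}\ \langle y_1,\dots,y_n\rangle\ \mathsf{of}\ \{\bar b\Rightarrow\mathsf{sample}_{d_{\bar b}}\}_{\bar b\in\{\mathtt t,\mathtt f\}^n}$. **Intersection types.** Fix a countable set of names $X,Y,Z,\dots$. Ground types $K,L::=X\mid K\otimes L$; positive types $P,Q::=L\mid[A_1,\dots,A_n]$ (finite multiset, $n\ge0$); types $A,B::=P\mid P\multimap A$. A typing context is a total map from variables to positive types with all but finitely many variables mapped to $[]$; it splits into its ground part $\Lambda$ and its multiset part $\Gamma$; $\uplus$ is (pointwise)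 multiset union. $\mathrm{Nm}(\cdot)$ is the set of names occurring. Rules (premises $\Longrightarrow$ conclusion): - (i-sample) $\Lambda\vdash\mathsf{sample}_d:X$ if $X\notin\mathrm{Nm}(\Lambda)$. - (i-cond) $\Lambda,y_1:Y_1,\dots,y_n:Y_n\vdash\mathsf c\langle y_1,\dots,y_n\rangle:X$ if $X\notin\{Y_1,\dots,Y_n\}$ and $X\notin\mathrm{Nm}(\Lambda)$. - (i-var) $\Lambda,x:P\vdash x:P$. - (i-let) $\Lambda,\Gamma_1\vdash u:P$ and $\Lambda,\Gamma_2,x:P\vdash t:A$ $\Longrightarrow$ $\Lambda,\Gamma_1\uplus\Gamma_2\vdash\mathsf{let}\ x=u\ \mathsf{in}\ t:A$. - (i-pair) $\Lambda\vdash v:L_1$ and $\Lambda\vdash w:L_2$ $\Longrightarrow$ $\Lambda\vdash\langle v,w\rangle:L_1\otimes L_2$. - (i-letp) $\Lambda\vdash v:L_1\otimes L_2$ and $\Lambda,x:L_1,y:L_2,\Gamma\vdash t:A$ $\Longrightarrow$ $\Lambda,\Gamma\vdash\mathsf{letp}\ \langle x,y\rangle=v\ \mathsf{in}\ t:A$. - (i-abs) $\Lambda,\Gamma,x:P\vdash t:A$ $\Longrightarrow$ $\Lambda,\Gamma\vdash\lambda x.t:P\multimap A$. - (i-app) $\Lambda,\Gamma_1\vdash t:P\multimap A$ and $\Lambda,\Gamma_2\vdash v:P$ $\Longrightarrow$ $\Lambda,\Gamma_1\uplus\Gamma_2\vdash t\,v:A$. - (i-bang) $(\Lambda,\Gamma_i\vdash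 t:A_i)_{i=1}^n$, $n\ge0$ $\Longrightarrow$ $\Lambda,\biguplus_i\Gamma_i\vdash\,!t:[A_1,\dots,A_n]$. - (i-der) $\Lambda,\Gamma\vdash v:[A]$ $\Longrightarrow$ $\Lambda,\Gamma\vdash\mathsf{der}\,v:A$. Axioms (i-sample), (i-cond) are the *probabilistic axioms*; the name $X$ typing the subject is their *main name*. Naming condition (part of the definition of a derivation): main names are pairwise distinct. **Factors.** $\mathrm{Val}(X)=\{\mathtt t,\mathtt f\}$ for each name; for a finite set of names $\mathbb X$, $\mathrm{Val}(\mathbb X)=\prod_{X\in\mathbb X}\mathrm{Val}(X)$, and $\bar x|_{\mathbb Y}$ is restriction to $\mathbb Y\subseteq\mathbb X$. A factor over $\mathbb X$ is a function $\phi:\mathrm{Val}(\mathbb X)\to\mathbb R_{\ge0}$; $\mathrm{Nm}(\phi)=\mathbb X$. Sum out: for $\mathbb Z\subseteq\mathbb X$, $\sum_{\mathbb Z}\phi$ is the factor over $\mathbb X-\mathbb Z$ with $(\sum_{\mathbb Z}\phi)(\bar y)=\sum_{\bar z\in\mathrm{Val}(\mathbb Z)}\phi(\bar z\bar y)$. Product: $(\phi_1\odot\phi_2)(\bar z)=\phi_1(\bar z|_{\mathrm{Nm}(\phi_1)})\,\phi_2(\bar z|_{\mathrm{Nm}(\phi_2)})$, a factor over $\mathrm{Nm}(\phi_1)\cup\mathrm{Nm}(\phi_2)$; the empty product is the factor over $\emptyset$ with value $1$. **Semantics of a derivation.** To $\Lambda\vdash\mathsf{sample}_d:X$ is associated the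 factor over $\{X\}$ with $\phi(x)=d(x)$; to an (i-cond) axiom $\Lambda,y_1:Y_1,\dots,y_n:Y_n\vdash\mathsf{case}\ \langle y_1,\dots,y_n\rangle\ \mathsf{of}\ \{\bar b\Rightarrow\mathsf{sample}_{d_{\bar b}}\}_{\bar b\in\{\mathtt t,\mathtt f\}^n}:X$ is associated the factor over $\mathbb Y\cup\{X\}$, $\mathbb Y=\{Y_1,\dots,Y_n\}$, with $\phi(\bar y\,x)=d_{\langle\bar y|_{Y_1},\dots,\bar y|_{Y_n}\rangle}(x)$. For a derivation $\pi$ of a judgment $J$, let $\mathrm{Cpts}(\pi)$ be the family of factors associated with its probabilistic axioms and $\mathbb X=\bigcup_{\phi\in\mathrm{Cpts}(\pi)}\mathrm{Nm}(\phi)$; then $[\![\pi]\!]=\sum_{\mathbb X-\mathrm{Nm}(J)}\big(\bigodot_{\phi\in\mathrm{Cpts}(\pi)}\phi\big)$. **Bayesian networks.** A Bayesian network over a finite set of names $\mathbb X$ is a DAG $\mathcal G$ with node set $\mathbb X$ together with, for each $X\in\mathbb X$, a conditional probability table $\phi^X$: a factor over $\{X\}\cup\mathrm{Pa}(X)$ ($\mathrm{Pa}(X)$ the parents of $X$ in $\mathcal G$) with values in $[0,1]$ and $\sum_{x\in \mathrm{Val}(X)}\phi^X(x\bar y)=1$ for all $\bar y$. Its semantics is $[\![\mathcal B]\!]=\bigodot_{X\in\mathbb X}\phi^X$. **Flow graph.** The vertices of $\mathrm{flow}(\pi)$ (*positions*) are the occurrences of names in the types of the judgments of $\pi$. Polarity: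 in $x_1:P_1,\dots,x_k:P_k\vdash t:A$, occurrences in $A$ start as output and occurrences in the $P_i$ start as input; polarity is preserved by $\otimes$, by multisets and by the right of $\multimap$, and flipped on the left of $\multimap$. Edges: - (i-cond): from each $Y_i$ (in $y_i:Y_i$) to $X$. - (i-var): each occurrence in $x:P$ is linked to the same occurrence in the subject type $P$, oriented from the input one to the output one. - (i-let): each occurrence in the type $P$ of $u$ is linked to the same occurrence in $x:P$, oriented from output to input. (i-app): likewise between $P$ in the type $P\multimap A$ of $t$ and the type $P$ of $v$. (i-letp): likewise between $L_1$ (resp. $L_2$) in the type of $v$ and $x:L_1$ (resp. $y:L_2$). - In every rule, all other corresponding occurrences in a premise and in the conclusion (the type $A$; the components $L_1,L_2$ in (i-pair); $x:P$ and the left $P$ of $P\multimap A$ in (i-abs); the $A_i$ in (i-bang); $[A]$ and $A$ in (i-der); each ground context variable with its copies in all premises; each element of $\biguplus_i\Gamma_i$ with its origin in $\Gamma_i$) are linked, oriented from conclusion to premise for input occurrences and from premise to conclusion for output occurrences. **Extraction.** For $\pi$ deriving $\vdash t:L$, $\mathcal B_t$ is the Bayesian network over $\mathrm{Nm}(\pi)$ whose table at $X$ is the factor associated with the probabilistic axiom of $\pi$ with main name $X$, and whose graph is obtained from $\mathrm{flow}(\pi)$ by collapsing all vertices carrying the same name (discarding loops). -}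

module Defs where

open import Level using (Level; Lift; lift; _⊔_) renaming (suc to lsuc)
open import Algebra.Bundles using (CommutativeRing)
open import Data.Bool.Base using (Bool; true; false; not)
open import Data.Fin.Base using (Fin; zero; suc)
import Data.Fin.Properties as Fin
open import Data.List.Base
  using (List; []; _∷_; _++_; map; concat; foldr; filter; deduplicate)
  renaming (tabulate to tabulateᴸ)
open import Data.List.Membership.Propositional using (mapWith∈)
open import Data.List.Membership.Propositional.Properties
  using (∈-++⁺ˡ; ∈-++⁺ʳ; ∈-++⁻; ∈-filter⁺; ∈-filter⁻; ∈-deduplicate⁺; ∈-deduplicate⁻;
         ∈-map⁺; ∈-map⁻; ∈-concat⁺′; ∈-tabulate⁺)
open import Data.List.Relation.Binary.Permutation.Homogeneous as Perm using (Permutation)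
open import Data.List.Relation.Binary.Permutation.Propositional using (_↭_)
open import Data.List.Relation.Binary.Pointwise.Base using (Pointwise; []; _∷_)
open import Data.List.Relation.Unary.All as All using (All; []; _∷_)
open import Data.List.Relation.Unary.All.Properties as AllP using ()
open import Data.List.Relation.Unary.AllPairs.Core using ([]; _∷_)
open import Data.List.Relation.Unary.Any using (Any; here; there; tail)
open import Data.List.Relation.Unary.Any.Properties using (++⁺ˡ; ++⁺ʳ)
open import Data.List.Relation.Unary.Unique.Propositional using (Unique)
open import Data.List.Relation.Unary.Unique.Propositional.Properties as UniqueP using ()
open import Data.Nat.Base using (ℕ; zero; suc)
open import Data.Nat.Properties using (_≟_)
open import Data.List.Membership.DecPropositional _≟_ using (_∈_; _∉_; _∈?_)
open import Data.List.Relation.Unary.Unique.DecPropositional.Properties _≟_ using (deduplicate-!)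
open import Data.Product.Base using (Σ-syntax; _×_; _,_; proj₁; proj₂)
open import Data.Sum.Base using (_⊎_; inj₁; inj₂; [_,_]′)
open import Data.Unit.Polymorphic.Base using (⊤; tt)
open import Data.Vec.Base as Vec using (Vec; []; _∷_)
open import Data.Vec.Properties using (tabulate-cong)
open import Data.Vec.Membership.Propositional.Properties using (∈-lookup; ∈-toList⁺)
import Data.Vec.Functional as Fun
open import Function.Base using (_∘_; id)
open import Function.Definitions using (Injective)
open import Induction.WellFounded using (Acc; acc; acc⇒asym)
open import Relation.Binary.Construct.Closure.Transitive using (TransClosure)
  renaming (accessible to accessible⁺)
import Relation.Binary.Construct.Closure.Transitive as Trans
open import Relation.Binary.Core using (Rel)
open import Relation.Binary.PropositionalEquality
  using (_≡_; _≢_; refl; sym; trans; cong; subst)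
open import Relation.Binary.Structures using (IsPartialOrder)
open import Relation.Nullary using (¬_; Dec; yes; no; contradiction)
open import Relation.Nullary.Decidable using (¬?)

-- The standard library has no real numbers, so ℝ is replaced by an
-- arbitrary ordered commutative ring; probabilities and factors take values in
-- its nonnegative elements.

record OrderedCommutativeRing c ℓ₁ ℓ₂ : Set (lsuc (c ⊔ ℓ₁ ⊔ ℓ₂)) where
  infix 4 _≤_
  field
    commutativeRing : CommutativeRing c ℓ₁
  open CommutativeRing commutativeRing public
    hiding (zero)
    renaming (refl to ≈-refl; sym to ≈-sym; trans to ≈-trans)
  field
    _≤_            : Rel Carrier ℓ₂
    isPartialOrder : IsPartialOrder _≈_ _≤_
    +-mono-≤       : ∀ {x y u v} → x ≤ y → u ≤ v → x + u ≤ y + v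
    *-nonneg       : ∀ {x y} → 0# ≤ x → 0# ≤ y → 0# ≤ x * y
    0≤1            : 0# ≤ 1#
  module ≤ = IsPartialOrder isPartialOrder

Name : Set
Name = ℕ

record FinSet : Set where
  field
    elems  : List Name
    unique : Unique elems
open FinSet public

infix 4 _∈ˢ_ _⊆ˢ_

_∈ˢ_ : Name → FinSet → Set
X ∈ˢ 𝕏 = X ∈ elems 𝕏

_⊆ˢ_ : FinSet → FinSet → Set
𝕐 ⊆ˢ 𝕏 = ∀ {X} → X ∈ˢ 𝕐 → X ∈ˢ 𝕏

∅ : FinSet
∅ = record { elems = [] ; unique = [] }

⁅_⁆ : Name → FinSet
⁅ X ⁆ = record { elems = X ∷ [] ; unique = [] ∷ [] }

fromList : List Name → FinSet
fromList Xs = record { elems = deduplicate _≟_ Xs ; unique = deduplicate-! Xs }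

infixl 6 _∪_ _∖_

_∪_ : FinSet → FinSet → FinSet
𝕏 ∪ 𝕐 = fromList (elems 𝕏 ++ elems 𝕐)

_∖_ : FinSet → FinSet → FinSet
𝕏 ∖ 𝕐 = record
  { elems  = filter (λ X → ¬? (X ∈? elems 𝕐)) (elems 𝕏)
  ; unique = UniqueP.filter⁺ (λ X → ¬? (X ∈? elems 𝕐)) (unique 𝕏)
  }

∈-fromList⁺ : ∀ {X Xs} → X ∈ Xs → X ∈ˢ fromList Xs
∈-fromList⁺ = ∈-deduplicate⁺ _≟_

∈-fromList⁻ : ∀ {X} Xs → X ∈ˢ fromList Xs → X ∈ Xs
∈-fromList⁻ Xs = ∈-deduplicate⁻ _≟_ Xs

∪-⁺ˡ : ∀ 𝕏 𝕐 → 𝕏 ⊆ˢ (𝕏 ∪ 𝕐)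
∪-⁺ˡ _ _ p = ∈-fromList⁺ (∈-++⁺ˡ p)

∪-⁺ʳ : ∀ 𝕏 𝕐 → 𝕐 ⊆ˢ (𝕏 ∪ 𝕐)
∪-⁺ʳ 𝕏 _ p = ∈-fromList⁺ (∈-++⁺ʳ (elems 𝕏) p)

∪-⁻ : ∀ 𝕏 𝕐 {X} → X ∈ˢ (𝕏 ∪ 𝕐) → X ∈ˢ 𝕏 ⊎ X ∈ˢ 𝕐
∪-⁻ 𝕏 𝕐 p = ∈-++⁻ (elems 𝕏) (∈-fromList⁻ (elems 𝕏 ++ elems 𝕐) p)

⁅⁆-⊆ : ∀ 𝕏 {X} → X ∈ˢ 𝕏 → ⁅ X ⁆ ⊆ˢ 𝕏
⁅⁆-⊆ 𝕏 p (here refl) = p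

∖-⁺ : ∀ 𝕏 𝕐 {X} → X ∈ˢ 𝕏 → ¬ X ∈ˢ 𝕐 → X ∈ˢ (𝕏 ∖ 𝕐)
∖-⁺ 𝕏 𝕐 p q = ∈-filter⁺ (λ X → ¬? (X ∈? elems 𝕐)) p q

∖-⊆ : ∀ 𝕏 𝕐 → (𝕏 ∖ 𝕐) ⊆ˢ 𝕏
∖-⊆ 𝕏 𝕐 p = proj₁ (∈-filter⁻ (λ X → ¬? (X ∈? elems 𝕐)) {xs = elems 𝕏} p)

-- Membership is irrelevant, so a valuation assigns a single boolean to each
-- name of the set.

ValOn : List Name → Set
ValOn Xs = ∀ X → .(X ∈ Xs) → Bool

Val : FinSet → Set
Val 𝕏 = ValOn (elems 𝕏)

infix 4 _≐_

_≐_ : ∀ {Xs} → ValOn Xs → ValOn Xs → Set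
_≐_ {Xs} x̄ ȳ = ∀ X → .(p : X ∈ Xs) → x̄ X p ≡ ȳ X p

restrict : ∀ {𝕏 𝕐} → .(𝕐 ⊆ˢ 𝕏) → Val 𝕏 → Val 𝕐
restrict 𝕐⊆𝕏 x̄ X p = x̄ X (𝕐⊆𝕏 p)

glueAt : ∀ {𝕏 ℤ} X → .(X ∈ˢ 𝕏) → Dec (X ∈ˢ ℤ) → Val ℤ → Val (𝕏 ∖ ℤ) → Bool
glueAt         X p (yes q) z̄ ȳ = z̄ X q
glueAt {𝕏} {ℤ} X p (no ¬q) z̄ ȳ = ȳ X (∖-⁺ 𝕏 ℤ p ¬q)

glue : ∀ {𝕏 ℤ} → Val ℤ → Val (𝕏 ∖ ℤ) → Val 𝕏
glue {𝕏} {ℤ} z̄ ȳ X p = glueAt {𝕏} {ℤ} X p (X ∈? elems ℤ) z̄ ȳ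

consAt : ∀ {X Xs} Y → .(Y ∈ X ∷ Xs) → Dec (Y ≡ X) → Bool → ValOn Xs → Bool
consAt Y p (yes _)   b z̄ = b
consAt Y p (no Y≢X) b z̄ = z̄ Y (tail Y≢X p)

cons : ∀ {X Xs} → Bool → ValOn Xs → ValOn (X ∷ Xs)
cons {X} b z̄ Y p = consAt Y p (Y ≟ X) b z̄

valsOn : ∀ Xs → List (ValOn Xs)
valsOn []       = (λ _ ()) ∷ []
valsOn (X ∷ Xs) = map (cons true) (valsOn Xs) ++ map (cons false) (valsOn Xs)

vals : ∀ ℤ → List (Val ℤ)
vals ℤ = valsOn (elems ℤ)

-- A multiset is a list; equality of types is taken up to permutation (_≅ᵀ_
-- below), at every depth.

infixr 7 _⊗_
infixr 6 _⊸_

data Ground : Set where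
  name : Name → Ground
  _⊗_  : Ground → Ground → Ground

data Positive : Set
data Ty : Set

data Positive where
  ground : Ground → Positive
  bag    : List Ty → Positive

data Ty where
  pos : Positive → Ty
  _⊸_ : Positive → Ty → Ty

atom : Name → Ty
atom X = pos (ground (name X))

infix 4 _≅ᴾ_ _≅ᵀ_

data _≅ᴾ_ : Positive → Positive → Set
data _≅ᵀ_ : Ty → Ty → Set

data _≅ᴾ_ where
  ground : ∀ {L} → ground L ≅ᴾ ground L
  bag    : ∀ {As Bs} → Permutation _≅ᵀ_ As Bs → bag As ≅ᴾ bag Bs

data _≅ᵀ_ where
  pos : ∀ {P Q} → P ≅ᴾ Q → pos P ≅ᵀ pos Q
  _⊸_ : ∀ {P Q A B} → P ≅ᴾ Q → A ≅ᵀ B → P ⊸ A ≅ᵀ Q ⊸ B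

namesᴳ : Ground → List Name
namesᴳ (name X) = X ∷ []
namesᴳ (K ⊗ L)  = namesᴳ K ++ namesᴳ L

namesᴾ : Positive → List Name
namesᴸ : List Ty → List Name
namesᵀ : Ty → List Name

namesᴾ (ground L) = namesᴳ L
namesᴾ (bag As)   = namesᴸ As

namesᴸ []       = []
namesᴸ (A ∷ As) = namesᵀ A ++ namesᴸ As

namesᵀ (pos P) = namesᴾ P
namesᵀ (P ⊸ A) = namesᴾ P ++ namesᵀ A

Nmᴳ : Ground → FinSet
Nmᴳ L = fromList (namesᴳ L)

data Occᴳ : Ground → Set where
  name  : ∀ {X} → Occᴳ (name X)
  left  : ∀ {K L} → Occᴳ K → Occᴳ (K ⊗ L)
  right : ∀ {K L} → Occᴳ L → Occᴳ (K ⊗ L)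

data Occᴾ : Positive → Set
data Occᵀ : Ty → Set

data Occᴾ where
  ground : ∀ {L} → Occᴳ L → Occᴾ (ground L)
  bag    : ∀ {As} → Any Occᵀ As → Occᴾ (bag As)

data Occᵀ where
  pos : ∀ {P} → Occᴾ P → Occᵀ (pos P)
  dom : ∀ {P A} → Occᴾ P → Occᵀ (P ⊸ A)
  cod : ∀ {P A} → Occᵀ A → Occᵀ (P ⊸ A)

nmᴳ : ∀ {L} → Occᴳ L → Name
nmᴳ (name {X}) = X
nmᴳ (left o)   = nmᴳ o
nmᴳ (right o)  = nmᴳ o

nmᴾ : ∀ {P} → Occᴾ P → Name
nmᴸ : ∀ {As} → Any Occᵀ As → Name
nmᵀ : ∀ {A} → Occᵀ A → Name

nmᴾ (ground o) = nmᴳ o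
nmᴾ (bag o)    = nmᴸ o

nmᴸ (here o)  = nmᵀ o
nmᴸ (there o) = nmᴸ o

nmᵀ (pos o) = nmᴾ o
nmᵀ (dom o) = nmᴾ o
nmᵀ (cod o) = nmᵀ o

data Polarity : Set where
  input output : Polarity

opposite : Polarity → Polarity
opposite input  = output
opposite output = input

-- The first argument is the polarity of the whole type.
polᴾ : ∀ {P} → Polarity → Occᴾ P → Polarity
polᴸ : ∀ {As} → Polarity → Any Occᵀ As → Polarity
polᵀ : ∀ {A} → Polarity → Occᵀ A → Polarity

polᴾ s (ground o) = s
polᴾ s (bag o)    = polᴸ s o

polᴸ s (here o)  = polᵀ s o
polᴸ s (there o) = polᴸ s o

polᵀ s (pos o) = polᴾ s o
polᵀ s (dom o) = polᴾ (opposite s) o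
polᵀ s (cod o) = polᵀ s o

-- "The same occurrence" in two equal types: a proof of equality up to
-- permutation says which elements of the multisets are matched.

castᴾ : ∀ {P Q} → P ≅ᴾ Q → Occᴾ P → Occᴾ Q
castᵀ : ∀ {A B} → A ≅ᵀ B → Occᵀ A → Occᵀ B
castᴸ : ∀ {As Bs} → Permutation _≅ᵀ_ As Bs → Any Occᵀ As → Any Occᵀ Bs
castᵂ : ∀ {As Bs} → Pointwise _≅ᵀ_ As Bs → Any Occᵀ As → Any Occᵀ Bs

castᴾ ground  o       = o
castᴾ (bag e) (bag o) = bag (castᴸ e o)

castᵀ (pos e)  (pos o) = pos (castᴾ e o)
castᵀ (e ⊸ e′) (dom o) = dom (castᴾ e o)
castᵀ (e ⊸ e′) (cod o) = cod (castᵀ e′ o)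

castᴸ (Perm.refl es)      o                 = castᵂ es o
castᴸ (Perm.prep e es)    (here o)          = here (castᵀ e o)
castᴸ (Perm.prep e es)    (there o)         = there (castᴸ es o)
castᴸ (Perm.swap e e′ es) (here o)          = there (here (castᵀ e o))
castᴸ (Perm.swap e e′ es) (there (here o))  = here (castᵀ e′ o)
castᴸ (Perm.swap e e′ es) (there (there o)) = there (there (castᴸ es o))
castᴸ (Perm.trans es es′) o                 = castᴸ es′ (castᴸ es o)

castᵂ (e ∷ es) (here o)  = here (castᵀ e o)
castᵂ (e ∷ es) (there o) = there (castᵂ es o)

-- Terms are well-scoped de Bruijn terms, so a context only records the types of
-- the variables in scope.  The ground part Λ consists of the variables
-- of ground type, the multiset part Γ of the others.

Ctx : ℕ → Set
Ctx n = Fun.Vector Positive n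

infixr 5 _◂_
_◂_ : ∀ {n} → Positive → Ctx n → Ctx (suc n)
_◂_ = Fun._∷_

∙ : Ctx 0
∙ = Fun.[]

namesᶜ : ∀ {n} → Ctx n → List Name
namesᶜ Γ = concat (tabulateᴸ (λ x → namesᴾ (Γ x)))

data GroundOrEmpty : Positive → Set where
  ground : ∀ {L} → GroundOrEmpty (ground L)
  empty  : GroundOrEmpty (bag [])

-- The context has an empty multiset part, i.e. is of the form Λ.
GroundOnly : ∀ {n} → Ctx n → Set
GroundOnly Γ = ∀ x → GroundOrEmpty (Γ x)

dropBag : Positive → Positive
dropBag (ground L) = ground L
dropBag (bag _)    = bag []

groundPart : ∀ {n} → Ctx n → Ctx n
groundPart Γ x = dropBag (Γ x)

infix 4 _⊎_≔_ _⊎ᶜ_≔_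

data _⊎_≔_ : Positive → Positive → Positive → Set where
  ground : ∀ {L} → ground L ⊎ ground L ≔ ground L
  bag    : ∀ {As Bs} → bag As ⊎ bag Bs ≔ bag (As ++ Bs)

-- Γ₁ and Γ₂ have the same ground part Λ, and Γ is Λ together with the union of
-- their multiset parts.
_⊎ᶜ_≔_ : ∀ {n} → Ctx n → Ctx n → Ctx n → Set
Γ₁ ⊎ᶜ Γ₂ ≔ Γ = ∀ x → Γ₁ x ⊎ Γ₂ x ≔ Γ x

data Occ {n} (Γ : Ctx n) (A : Ty) : Set where
  ctx  : ∀ x → Occᴾ (Γ x) → Occ Γ A
  subj : Occᵀ A → Occ Γ A

nmᴼ : ∀ {n} {Γ : Ctx n} {A} → Occ Γ A → Name
nmᴼ (ctx x o) = nmᴾ o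
nmᴼ (subj o)  = nmᵀ o

polarity : ∀ {n} {Γ : Ctx n} {A} → Occ Γ A → Polarity
polarity (ctx x o) = polᴾ input o
polarity (subj o)  = polᵀ output o

fromˡ : ∀ {P Q R} → P ⊎ Q ≔ R → Occᴾ P → Occᴾ R
fromˡ ground o       = o
fromˡ bag    (bag o) = bag (++⁺ˡ o)

fromʳ : ∀ {P Q R} → P ⊎ Q ≔ R → Occᴾ Q → Occᴾ R
fromʳ ground           o       = o
fromʳ (bag {As} {Bs})  (bag o) = bag (++⁺ʳ As o)

fromDrop : ∀ P → Occᴾ (dropBag P) → Occᴾ P
fromDrop (ground L) o            = o
fromDrop (bag As)   (bag ())

module Calculus {c ℓ₁ ℓ₂} (ℝ : OrderedCommutativeRing c ℓ₁ ℓ₂) where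

  open OrderedCommutativeRing ℝ

  ℓ : Level
  ℓ = c ⊔ ℓ₁ ⊔ ℓ₂

  record Dist : Set ℓ where
    field
      prob   : Bool → Carrier
      nonneg : ∀ b → 0# ≤ prob b
      total  : prob true + prob false ≈ 1#

  record Factor : Set ℓ where
    field
      Nm     : FinSet
      eval   : Val Nm → Carrier
      nonneg : ∀ x̄ → 0# ≤ eval x̄
      -- Functions on valuations respect pointwise equality; this has to be
      -- required in the absence of function extensionality.
      ext    : ∀ {x̄ ȳ} → x̄ ≐ ȳ → eval x̄ ≈ eval ȳ

  open Factor using () renaming (Nm to Nmᶠ; eval to evalᶠ) public

  infix 4 _≋_

  _≋_ : Factor → Factor → Set ℓ₁
  φ ≋ ψ = (Nmᶠ φ ⊆ˢ Nmᶠ ψ) ×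
          Σ[ ψ⊆φ ∈ Nmᶠ ψ ⊆ˢ Nmᶠ φ ]
            (∀ x̄ → evalᶠ φ x̄ ≈ evalᶠ ψ (restrict {Nmᶠ φ} {Nmᶠ ψ} ψ⊆φ x̄))

  sum : List Carrier → Carrier
  sum = foldr _+_ 0#

  sum-map-nonneg : ∀ {a} {A : Set a} (f : A → Carrier) → (∀ x → 0# ≤ f x) →
                   ∀ xs → 0# ≤ sum (map f xs)
  sum-map-nonneg f h []       = ≤.refl
  sum-map-nonneg f h (x ∷ xs) =
    ≤.trans (≤.reflexive (≈-sym (+-identityˡ 0#))) (+-mono-≤ (h x) (sum-map-nonneg f h xs))

  sum-map-cong : ∀ {a} {A : Set a} (f g : A → Carrier) → (∀ x → f x ≈ g x) →
                 ∀ xs → sum (map f xs) ≈ sum (map g xs)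
  sum-map-cong f g h []       = ≈-refl
  sum-map-cong f g h (x ∷ xs) = +-cong (h x) (sum-map-cong f g h xs)

  glue-cong : ∀ {𝕏 ℤ} (z̄ : Val ℤ) {x̄ ȳ : Val (𝕏 ∖ ℤ)} → x̄ ≐ ȳ →
              glue {𝕏} {ℤ} z̄ x̄ ≐ glue {𝕏} {ℤ} z̄ ȳ
  glue-cong {𝕏} {ℤ} z̄ e X p with X ∈? elems ℤ
  ... | yes _ = refl
  ... | no ¬q = e X (∖-⁺ 𝕏 ℤ p ¬q)

  sumOut : (ℤ : FinSet) (φ : Factor) → .(ℤ ⊆ˢ Nmᶠ φ) → Factor
  sumOut ℤ φ _ = record
    { Nm     = Nm ∖ ℤ
    ; eval   = λ ȳ → sum (map (λ z̄ → eval (glue {Nm} {ℤ} z̄ ȳ)) (vals ℤ))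
    ; nonneg = λ ȳ → sum-map-nonneg _ (λ z̄ → nonneg (glue {Nm} {ℤ} z̄ ȳ)) (vals ℤ)
    ; ext    = λ e → sum-map-cong _ _ (λ z̄ → ext (glue-cong {Nm} {ℤ} z̄ e)) (vals ℤ)
    }
    where open Factor φ

  infixr 7 _⊙_

  _⊙_ : Factor → Factor → Factor
  φ ⊙ ψ = record
    { Nm     = φ.Nm ∪ ψ.Nm
    ; eval   = λ z̄ → φ.eval (z̄ |φ) * ψ.eval (z̄ |ψ)
    ; nonneg = λ z̄ → *-nonneg (φ.nonneg _) (ψ.nonneg _)
    ; ext    = λ e → *-cong (φ.ext (λ X p → e X (∪-⁺ˡ φ.Nm ψ.Nm p)))
                            (ψ.ext (λ X p → e X (∪-⁺ʳ φ.Nm ψ.Nm p)))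
    }
    where
    module φ = Factor φ
    module ψ = Factor ψ
    _|φ : Val (φ.Nm ∪ ψ.Nm) → Val φ.Nm
    _|φ = restrict {φ.Nm ∪ ψ.Nm} {φ.Nm} (∪-⁺ˡ φ.Nm ψ.Nm)
    _|ψ : Val (φ.Nm ∪ ψ.Nm) → Val ψ.Nm
    _|ψ = restrict {φ.Nm ∪ ψ.Nm} {ψ.Nm} (∪-⁺ʳ φ.Nm ψ.Nm)

  𝟙 : Factor
  𝟙 = record { Nm = ∅ ; eval = λ _ → 1# ; nonneg = λ _ → 0≤1 ; ext = λ _ → ≈-refl }

  ⨀ : List Factor → Factor
  ⨀ = foldr _⊙_ 𝟙

  record BayesianNetwork (𝕏 : FinSet) : Set (lsuc ℓ) where
    infix 4 _⟶_
    field
      _⟶_     : Rel Name ℓ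
      edge-∈  : ∀ {Y X} → Y ⟶ X → Y ∈ˢ 𝕏 × X ∈ˢ 𝕏
      acyclic : ∀ {X} → ¬ TransClosure _⟶_ X X

      table   : ∀ {X} → X ∈ˢ 𝕏 → Factor
      -- Nm (table p) = {X} ∪ Pa(X)
      Nm-⊇    : ∀ {X} (p : X ∈ˢ 𝕏) → ∀ {Y} → Y ≡ X ⊎ Y ⟶ X → Y ∈ˢ Nmᶠ (table p)
      Nm-⊆    : ∀ {X} (p : X ∈ˢ 𝕏) → ∀ {Y} → Y ∈ˢ Nmᶠ (table p) → Y ≡ X ⊎ Y ⟶ X

      ≤1      : ∀ {X} (p : X ∈ˢ 𝕏) x̄ → evalᶠ (table p) x̄ ≤ 1#
      total   : ∀ {X} (p : X ∈ˢ 𝕏) ȳ →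
                evalᶠ (sumOut ⁅ X ⁆ (table p) (⁅⁆-⊆ (Nmᶠ (table p)) (Nm-⊇ p (inj₁ refl)))) ȳ ≈ 1#

  ⟦_⟧ᴮ : ∀ {𝕏} → BayesianNetwork 𝕏 → Factor
  ⟦_⟧ᴮ {𝕏} 𝓑 = ⨀ (mapWith∈ (elems 𝕏) (BayesianNetwork.table 𝓑))

  infix 30 `_ !_

  data Value (n : ℕ) : Set ℓ
  data Term (n : ℕ) : Set ℓ

  data Value n where
    `_    : Fin n → Value n
    ⟨_,_⟩ : Value n → Value n → Value n
    !_    : Term n → Value n
    bool  : Bool → Value n

  data Term n where
    val     : Value n → Term n
    sample  : Dist → Term n
    case    : Value n → List (Value n × Dist) → Term n
    obs     : Fin n → Bool → Term n
    let-in  : Term n → Term (suc n) → Term n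
    -- letp ⟨x,y⟩ = v in t: in t, y is variable 0 and x is variable 1.
    letp-in : Value n → Term (suc (suc n)) → Term n
    _·_     : Term n → Value n → Term n
    ƛ_      : Term (suc n) → Term n
    der     : Value n → Term n

  -- ⟨v₁,…,vₖ⟩ = ⟨v₁,⟨v₂,…⟩⟩, with ⟨v₁⟩ = v₁.
  tuple : ∀ {n k} → Vec (Value n) (suc k) → Value n
  tuple (v ∷ [])     = v
  tuple (v ∷ w ∷ vs) = ⟨ v , tuple (w ∷ vs) ⟩

  bools : ∀ k → List (Vec Bool k)
  bools zero    = [] ∷ []
  bools (suc k) = map (true ∷_) (bools k) ++ map (false ∷_) (bools k)

  branches : ∀ {n k} → (Vec Bool (suc k) → Dist) → List (Value n × Dist)
  branches {k = k} d = map (λ b̄ → tuple (Vec.map bool b̄) , d b̄) (bools (suc k))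

  -- Two occurrences of one type in the premises of a rule are only required to
  -- be equal up to permutation in the let and application rules.  All other
  -- types can be chosen to agree as lists.

  infix 3 _⊢_∶_ _⊢!_∶_

  data _⊢_∶_ {n} (Γ : Ctx n) : Term n → Ty → Set ℓ
  data _⊢!_∶_ {n} (Γ : Ctx n) : Term n → List Ty → Set ℓ

  data _⊢_∶_ {n} Γ where

    sample : ∀ {d X} → GroundOnly Γ → X ∉ namesᶜ Γ → Γ ⊢ sample d ∶ atom X

    -- Γ is Λ, y₁ : Y₁, …, yₖ : Yₖ, so X ∉ Nm(Γ) covers both side conditions.  The
    -- branches of a case may be listed in any order.
    cond : ∀ {k X bs} (ys : Vec (Fin n) (suc k)) (Ys : Vec Name (suc k))
           (d : Vec Bool (suc k) → Dist) →
           bs ↭ branches d →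
           Injective _≡_ _≡_ (Vec.lookup ys) →
           (∀ i → Γ (Vec.lookup ys i) ≡ ground (name (Vec.lookup Ys i))) →
           GroundOnly Γ → X ∉ namesᶜ Γ →
           Γ ⊢ case (tuple (Vec.map `_ ys)) bs ∶ atom X

    var : ∀ x → (∀ y → y ≢ x → GroundOrEmpty (Γ y)) → Γ ⊢ val (` x) ∶ pos (Γ x)

    let-in : ∀ {Γ₁ Γ₂ P P′ A t u} → Γ₁ ⊎ᶜ Γ₂ ≔ Γ → P ≅ᴾ P′ →
             Γ₁ ⊢ u ∶ pos P → P′ ◂ Γ₂ ⊢ t ∶ A → Γ ⊢ let-in u t ∶ A

    pair : ∀ {v w L₁ L₂} → GroundOnly Γ →
           Γ ⊢ val v ∶ pos (ground L₁) → Γ ⊢ val w ∶ pos (ground L₂) →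
           Γ ⊢ val ⟨ v , w ⟩ ∶ pos (ground (L₁ ⊗ L₂))

    letp-in : ∀ {v t L₁ L₂ A} →
              groundPart Γ ⊢ val v ∶ pos (ground (L₁ ⊗ L₂)) →
              ground L₂ ◂ ground L₁ ◂ Γ ⊢ t ∶ A → Γ ⊢ letp-in v t ∶ A

    abs : ∀ {P A t} → P ◂ Γ ⊢ t ∶ A → Γ ⊢ ƛ t ∶ P ⊸ A

    app : ∀ {Γ₁ Γ₂ P P′ A t v} → Γ₁ ⊎ᶜ Γ₂ ≔ Γ → P ≅ᴾ P′ →
          Γ₁ ⊢ t ∶ P ⊸ A → Γ₂ ⊢ val v ∶ pos P′ → Γ ⊢ t · v ∶ A

    bang : ∀ {t As} → Γ ⊢! t ∶ As → Γ ⊢ val (! t) ∶ pos (bag As)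

    der : ∀ {v A} → Γ ⊢ val v ∶ pos (bag (A ∷ [])) → Γ ⊢ der v ∶ A

  -- The finite family of premises of the bang rule: Γ is Λ together with the
  -- union of the multiset parts of the contexts of the premises.
  data _⊢!_∶_ {n} Γ where
    []  : ∀ {t} → GroundOnly Γ → Γ ⊢! t ∶ []
    add : ∀ {Γ₁ Γ₂ t A As} → Γ₁ ⊎ᶜ Γ₂ ≔ Γ → Γ₁ ⊢ t ∶ A → Γ₂ ⊢! t ∶ As →
          Γ ⊢! t ∶ (A ∷ As)

  namesᴶ : ∀ {n} → Ctx n → Ty → List Name
  namesᴶ Γ A = namesᶜ Γ ++ namesᵀ A

  names   : ∀ {n} {Γ : Ctx n} {t A} → Γ ⊢ t ∶ A → List Name
  names⁻  : ∀ {n} {Γ : Ctx n} {t A} → Γ ⊢ t ∶ A → List Name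
  names!  : ∀ {n} {Γ : Ctx n} {t As} → Γ ⊢! t ∶ As → List Name

  names {Γ = Γ} {A = A} π = namesᴶ Γ A ++ names⁻ π

  names⁻ (sample _ _)         = []
  names⁻ (cond _ _ _ _ _ _ _ _) = []
  names⁻ (var _ _)            = []
  names⁻ (let-in _ _ π₁ π₂)   = names π₁ ++ names π₂
  names⁻ (pair _ π₁ π₂)       = names π₁ ++ names π₂
  names⁻ (letp-in π₁ π₂)      = names π₁ ++ names π₂
  names⁻ (abs π)              = names π
  names⁻ (app _ _ π₁ π₂)      = names π₁ ++ names π₂
  names⁻ (bang πs)            = names! πs
  names⁻ (der π)              = names π

  names! ([] _)       = []
  names! (add _ π πs) = names π ++ names! πs

  -- Probabilistic axioms, reduced to what their factors depend on.

  data Axiom : Set ℓ where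
    sample : Name → Dist → Axiom
    cond   : ∀ {k} (Ys : Vec Name (suc k)) (X : Name) → X ∉ Vec.toList Ys →
             (Vec Bool (suc k) → Dist) → Axiom

  main : Axiom → Name
  main (sample X _)   = X
  main (cond _ X _ _) = X

  parents : Axiom → List Name
  parents (sample _ _)    = []
  parents (cond Ys _ _ _) = Vec.toList Ys

  lookup-∈ : ∀ {k} (Ys : Vec Name k) i → Vec.lookup Ys i ∈ Vec.toList Ys
  lookup-∈ Ys i = ∈-toList⁺ (∈-lookup i Ys)

  factor : Axiom → Factor
  factor (sample X d) = record
    { Nm     = ⁅ X ⁆
    ; eval   = λ x̄ → prob (x̄ X (here refl))
    ; nonneg = λ x̄ → nonneg _
    ; ext    = λ e → reflexive (cong prob (e X (here refl)))
    }
    where open Dist d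
  factor (cond Ys X _ d) = record
    { Nm     = 𝕐 ∪ ⁅ X ⁆
    ; eval   = λ x̄ → prob (d (ȳ x̄)) (x̄ X X∈)
    ; nonneg = λ x̄ → nonneg (d (ȳ x̄)) _
    ; ext    = λ {x̄} {x̄′} e →
        ≈-trans (reflexive (cong (prob (d (ȳ x̄))) (e X X∈)))
                (reflexive (cong (λ b̄ → prob (d b̄) (x̄′ X X∈))
                                 (tabulate-cong λ i → e (Vec.lookup Ys i) (Y∈ i))))
    }
    where
    open Dist
    𝕐 : FinSet
    𝕐 = fromList (Vec.toList Ys)
    X∈ : X ∈ˢ (𝕐 ∪ ⁅ X ⁆)
    X∈ = ∪-⁺ʳ 𝕐 ⁅ X ⁆ (here refl)
    Y∈ : ∀ i → Vec.lookup Ys i ∈ˢ (𝕐 ∪ ⁅ X ⁆)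
    Y∈ i = ∪-⁺ˡ 𝕐 ⁅ X ⁆ (∈-fromList⁺ (lookup-∈ Ys i))
    ȳ : Val (𝕐 ∪ ⁅ X ⁆) → Vec Bool _
    ȳ x̄ = Vec.tabulate λ i → x̄ (Vec.lookup Ys i) (Y∈ i)

  namesᶜ-∈ : ∀ {n} (Γ : Ctx n) x {X} → X ∈ namesᴾ (Γ x) → X ∈ namesᶜ Γ
  namesᶜ-∈ Γ x p = ∈-concat⁺′ p (∈-tabulate⁺ x)

  typed-∈ : ∀ {n k} (Γ : Ctx n) (ys : Vec (Fin n) k) (Ys : Vec Name k) →
            (∀ i → Γ (Vec.lookup ys i) ≡ ground (name (Vec.lookup Ys i))) →
            ∀ {X} → X ∈ Vec.toList Ys → X ∈ namesᶜ Γ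
  typed-∈ Γ (y ∷ ys) (Y ∷ Ys) h (here refl) =
    namesᶜ-∈ Γ y (subst (λ P → Y ∈ namesᴾ P) (sym (h zero)) (here refl))
  typed-∈ Γ (y ∷ ys) (Y ∷ Ys) h (there p) = typed-∈ Γ ys Ys (h ∘ suc) p

  axioms  : ∀ {n} {Γ : Ctx n} {t A} → Γ ⊢ t ∶ A → List Axiom
  axioms! : ∀ {n} {Γ : Ctx n} {t As} → Γ ⊢! t ∶ As → List Axiom

  axioms (sample {d} {X} _ _) = sample X d ∷ []
  axioms {Γ = Γ} (cond {X = X} ys Ys d _ _ h _ X∉) =
    cond Ys X (λ p → X∉ (typed-∈ Γ ys Ys h p)) d ∷ []
  axioms (var _ _)          = []
  axioms (let-in _ _ π₁ π₂) = axioms π₁ ++ axioms π₂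
  axioms (pair _ π₁ π₂)     = axioms π₁ ++ axioms π₂
  axioms (letp-in π₁ π₂)    = axioms π₁ ++ axioms π₂
  axioms (abs π)            = axioms π
  axioms (app _ _ π₁ π₂)    = axioms π₁ ++ axioms π₂
  axioms (bang πs)          = axioms! πs
  axioms (der π)            = axioms π

  axioms! ([] _)       = []
  axioms! (add _ π πs) = axioms π ++ axioms! πs

  record Derivation {n} (Γ : Ctx n) (t : Term n) (A : Ty) : Set ℓ where
    field
      tree   : Γ ⊢ t ∶ A
      naming : Unique (map main (axioms tree))
  open Derivation public

  Nm : ∀ {n} {Γ : Ctx n} {t A} → Derivation Γ t A → FinSet
  Nm π = fromList (names (tree π))

  Nmᴶ : ∀ {n} → Ctx n → Ty → FinSet
  Nmᴶ Γ A = fromList (namesᴶ Γ A)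

  Cpts : ∀ {n} {Γ : Ctx n} {t A} → Derivation Γ t A → List Factor
  Cpts π = map factor (axioms (tree π))

  ⟦_⟧ : ∀ {n} {Γ : Ctx n} {t A} → Derivation Γ t A → Factor
  ⟦_⟧ {Γ = Γ} {A = A} π = sumOut (𝕏 ∖ Nmᴶ Γ A) Φ (∖-⊆ 𝕏 (Nmᴶ Γ A))
    where
    Φ : Factor
    Φ = ⨀ (Cpts π)
    𝕏 : FinSet
    𝕏 = Nmᶠ Φ

  private
    variable
      n m k : ℕ
      Γ Γ₁ Γ₂ Δ Δ′ : Ctx n
      t u u′ : Term n
      v w : Value n
      L₁ L₂ : Ground
      P P′ : Positive
      A B B′ : Ty
      As : List Ty
      s : Γ₁ ⊎ᶜ Γ₂ ≔ Γ
      e : P ≅ᴾ P′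
      g : GroundOnly Γ
      π π₁ π₂ ρ ρ′ : Γ ⊢ t ∶ A
      πs : Γ ⊢! t ∶ As

  data Premise! : {n : ℕ} {Γ : Ctx n} {t : Term n} {As : List Ty} {Δ : Ctx n} {B : Ty} →
                  Γ ⊢! t ∶ As → Δ ⊢ t ∶ B → Set ℓ where
    head : Premise! (add s π πs) π
    next : Premise! πs ρ → Premise! (add s π πs) ρ

  -- The occurrence in the conclusion of bang that an occurrence in the context,
  -- resp. the type, of a premise stems from.

  ctx! : {πs : Γ ⊢! t ∶ As} {ρ : Δ ⊢ t ∶ B} →
         Premise! πs ρ → ∀ x → Occᴾ (Δ x) → Occᴾ (Γ x)
  ctx! (head {s = s})   x o = fromˡ (s x) o
  ctx! (next {s = s} i) x o = fromʳ (s x) (ctx! i x o)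

  subj! : {πs : Γ ⊢! t ∶ As} {ρ : Δ ⊢ t ∶ B} →
          Premise! πs ρ → Occᵀ B → Any Occᵀ As
  subj! head     o = here o
  subj! (next i) o = there (subj! i o)

  data Premise : {n m : ℕ} {Γ : Ctx n} {Δ : Ctx m} {t : Term n} {u : Term m} {A B : Ty} →
                 Γ ⊢ t ∶ A → Δ ⊢ u ∶ B → Set ℓ where
    let₁  : Premise (let-in s e π₁ π₂) π₁
    let₂  : Premise (let-in s e π₁ π₂) π₂
    pair₁ : Premise (pair g π₁ π₂) π₁
    pair₂ : Premise (pair g π₁ π₂) π₂
    letp₁ : {π₁ : groundPart Γ ⊢ val v ∶ pos (ground (L₁ ⊗ L₂))}
            {π₂ : ground L₂ ◂ ground L₁ ◂ Γ ⊢ t ∶ A} →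
            Premise (letp-in {Γ = Γ} π₁ π₂) π₁
    letp₂ : {π₁ : groundPart Γ ⊢ val v ∶ pos (ground (L₁ ⊗ L₂))}
            {π₂ : ground L₂ ◂ ground L₁ ◂ Γ ⊢ t ∶ A} →
            Premise (letp-in {Γ = Γ} π₁ π₂) π₂
    abs₁  : Premise (abs π) π
    app₁  : Premise (app s e π₁ π₂) π₁
    app₂  : Premise (app s e π₁ π₂) π₂
    bang  : Premise! πs ρ → Premise (bang πs) ρ
    der₁  : Premise (der π) π

  data Position {n} {Γ : Ctx n} {t A} (π : Γ ⊢ t ∶ A) : Set ℓ where
    here  : Occ Γ A → Position π
    there : ∀ {m} {Δ : Ctx m} {u B} {ρ : Δ ⊢ u ∶ B} →
            Premise π ρ → Position ρ → Position π

  nm : {π : Γ ⊢ t ∶ A} → Position π → Name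
  nm (here o)    = nmᴼ o
  nm (there i p) = nm p

  -- Corr i o′ o: the occurrence o′ in the premise i corresponds to the occurrence
  -- o in the conclusion.
  data Corr : {n m : ℕ} {Γ : Ctx n} {Δ : Ctx m} {t : Term n} {u : Term m} {A B : Ty}
              {π : Γ ⊢ t ∶ A} {ρ : Δ ⊢ u ∶ B} →
              Premise π ρ → Occ Δ B → Occ Γ A → Set ℓ where
    let₁   : ∀ x o → Corr (let₁ {s = s} {e = e} {π₁ = π₁} {π₂ = π₂})
                          (ctx x o) (ctx x (fromˡ (s x) o))
    let₂   : ∀ x o → Corr (let₂ {s = s} {e = e} {π₁ = π₁} {π₂ = π₂})
                          (ctx (suc x) o) (ctx x (fromʳ (s x) o))
    let₂ˢ  : ∀ o → Corr (let₂ {s = s} {e = e} {π₁ = π₁} {π₂ = π₂}) (subj o) (subj o)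

    pair₁  : ∀ x o → Corr (pair₁ {g = g} {π₁ = π₁} {π₂ = π₂}) (ctx x o) (ctx x o)
    pair₁ˢ : ∀ o → Corr (pair₁ {g = g} {π₁ = π₁} {π₂ = π₂})
                        (subj (pos (ground o))) (subj (pos (ground (left o))))
    pair₂  : ∀ x o → Corr (pair₂ {g = g} {π₁ = π₁} {π₂ = π₂}) (ctx x o) (ctx x o)
    pair₂ˢ : ∀ o → Corr (pair₂ {g = g} {π₁ = π₁} {π₂ = π₂})
                        (subj (pos (ground o))) (subj (pos (ground (right o))))

    letp₁  : ∀ {π₁ : groundPart Γ ⊢ val v ∶ pos (ground (L₁ ⊗ L₂))}
             {π₂ : ground L₂ ◂ ground L₁ ◂ Γ ⊢ t ∶ A} x o →
             Corr (letp₁ {Γ = Γ} {π₁ = π₁} {π₂ = π₂})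
                  (ctx x o) (ctx x (fromDrop (Γ x) o))
    letp₂  : ∀ {π₁ : groundPart Γ ⊢ val v ∶ pos (ground (L₁ ⊗ L₂))}
             {π₂ : ground L₂ ◂ ground L₁ ◂ Γ ⊢ t ∶ A} x o →
             Corr (letp₂ {Γ = Γ} {π₁ = π₁} {π₂ = π₂}) (ctx (suc (suc x)) o) (ctx x o)
    letp₂ˢ : ∀ {π₁ : groundPart Γ ⊢ val v ∶ pos (ground (L₁ ⊗ L₂))}
             {π₂ : ground L₂ ◂ ground L₁ ◂ Γ ⊢ t ∶ A} o →
             Corr (letp₂ {Γ = Γ} {π₁ = π₁} {π₂ = π₂}) (subj o) (subj o)

    abs    : ∀ x o → Corr (abs₁ {π = π}) (ctx (suc x) o) (ctx x o)
    absᵛ   : ∀ o → Corr (abs₁ {π = π}) (ctx zero o) (subj (dom o))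
    absˢ   : ∀ o → Corr (abs₁ {π = π}) (subj o) (subj (cod o))

    app₁   : ∀ x o → Corr (app₁ {s = s} {e = e} {π₁ = π₁} {π₂ = π₂})
                          (ctx x o) (ctx x (fromˡ (s x) o))
    app₁ˢ  : ∀ o → Corr (app₁ {s = s} {e = e} {π₁ = π₁} {π₂ = π₂}) (subj (cod o)) (subj o)
    app₂   : ∀ x o → Corr (app₂ {s = s} {e = e} {π₁ = π₁} {π₂ = π₂})
                          (ctx x o) (ctx x (fromʳ (s x) o))

    bang   : ∀ {i : Premise! πs ρ} x o → Corr (bang i) (ctx x o) (ctx x (ctx! i x o))
    bangˢ  : ∀ {i : Premise! πs ρ} o → Corr (bang i) (subj o) (subj (pos (bag (subj! i o))))

    der    : ∀ x o → Corr (der₁ {π = π}) (ctx x o) (ctx x o)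
    derˢ   : ∀ o → Corr (der₁ {π = π}) (subj (pos (bag (here o)))) (subj o)

  -- Cut i o j o′: o and o′ are the same occurrence in the type that the premises i
  -- and j of a rule have in common.
  data Cut : {n m k : ℕ} {Γ : Ctx n} {Δ : Ctx m} {Δ′ : Ctx k}
             {t : Term n} {u : Term m} {u′ : Term k} {A B B′ : Ty}
             {π : Γ ⊢ t ∶ A} {ρ : Δ ⊢ u ∶ B} {ρ′ : Δ′ ⊢ u′ ∶ B′} →
             Premise π ρ → Occ Δ B → Premise π ρ′ → Occ Δ′ B′ → Set ℓ where
    let-in : ∀ o → Cut (let₁ {s = s} {e = e} {π₁ = π₁} {π₂ = π₂}) (subj (pos o))
                       let₂ (ctx zero (castᴾ e o))
    app    : ∀ o → Cut (app₁ {s = s} {e = e} {π₁ = π₁} {π₂ = π₂}) (subj (dom o))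
                       app₂ (subj (pos (castᴾ e o)))
    letpˡ  : ∀ {π₁ : groundPart Γ ⊢ val v ∶ pos (ground (L₁ ⊗ L₂))}
             {π₂ : ground L₂ ◂ ground L₁ ◂ Γ ⊢ t ∶ A} o →
             Cut (letp₁ {Γ = Γ} {π₁ = π₁} {π₂ = π₂}) (subj (pos (ground (left o))))
                 letp₂ (ctx (suc zero) (ground o))
    letpʳ  : ∀ {π₁ : groundPart Γ ⊢ val v ∶ pos (ground (L₁ ⊗ L₂))}
             {π₂ : ground L₂ ◂ ground L₁ ◂ Γ ⊢ t ∶ A} o →
             Cut (letp₁ {Γ = Γ} {π₁ = π₁} {π₂ = π₂}) (subj (pos (ground (right o))))
                 letp₂ (ctx zero (ground o))

  data Flow : {n : ℕ} {Γ : Ctx n} {t : Term n} {A : Ty} (π : Γ ⊢ t ∶ A) →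
              Rel (Position π) ℓ where
    cond : ∀ {n k X bs} {Γ : Ctx n} {ys : Vec (Fin n) (suc k)} {Ys d} {perm : bs ↭ branches d}
           {inj : Injective _≡_ _≡_ (Vec.lookup ys)} {typed g} {X∉ : X ∉ namesᶜ Γ} i o →
           Flow (cond {Γ = Γ} ys Ys d perm inj typed g X∉)
                (here (ctx (Vec.lookup ys i) o)) (here (subj (pos (ground name))))

    var→ : ∀ {x g} {o : Occᴾ (Γ x)} → polᴾ input o ≡ input →
           Flow (var {Γ = Γ} x g) (here (ctx x o)) (here (subj (pos o)))
    var← : ∀ {x g} {o : Occᴾ (Γ x)} → polᴾ input o ≡ output →
           Flow (var {Γ = Γ} x g) (here (subj (pos o))) (here (ctx x o))

    cut→ : ∀ {i : Premise π ρ} {j : Premise π ρ′} {o o′} →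
           Cut i o j o′ → polarity o ≡ output →
           Flow π (there i (here o)) (there j (here o′))
    cut← : ∀ {i : Premise π ρ} {j : Premise π ρ′} {o o′} →
           Cut i o j o′ → polarity o ≡ input →
           Flow π (there j (here o′)) (there i (here o))

    up   : ∀ {i : Premise π ρ} {o′ o} → Corr i o′ o → polarity o ≡ input →
           Flow π (here o) (there i (here o′))
    down : ∀ {i : Premise π ρ} {o′ o} → Corr i o′ o → polarity o ≡ output →
           Flow π (there i (here o′)) (here o)

    inside : ∀ {i : Premise π ρ} {p q} → Flow ρ p q → Flow π (there i p) (there i q)

  Collapse : ∀ {n} {Γ : Ctx n} {t A} → Γ ⊢ t ∶ A → Rel Name ℓ
  Collapse π Y X = Y ≢ X × Σ[ p ∈ Position π ] Σ[ q ∈ Position π ]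
                             (Flow π p q × nm p ≡ Y × nm q ≡ X)

  castᴾ-nm : (e : P ≅ᴾ P′) (o : Occᴾ P) → nmᴾ (castᴾ e o) ≡ nmᴾ o
  castᵀ-nm : (e : A ≅ᵀ B) (o : Occᵀ A) → nmᵀ (castᵀ e o) ≡ nmᵀ o
  castᴸ-nm : ∀ {As Bs} (es : Permutation _≅ᵀ_ As Bs) (o : Any Occᵀ As) →
             nmᴸ (castᴸ es o) ≡ nmᴸ o
  castᵂ-nm : ∀ {As Bs} (es : Pointwise _≅ᵀ_ As Bs) (o : Any Occᵀ As) →
             nmᴸ (castᵂ es o) ≡ nmᴸ o

  castᴾ-nm ground  o       = refl
  castᴾ-nm (bag e) (bag o) = castᴸ-nm e o

  castᵀ-nm (pos e)  (pos o) = castᴾ-nm e o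
  castᵀ-nm (e ⊸ e′) (dom o) = castᴾ-nm e o
  castᵀ-nm (e ⊸ e′) (cod o) = castᵀ-nm e′ o

  castᴸ-nm (Perm.refl es)      o                 = castᵂ-nm es o
  castᴸ-nm (Perm.prep e es)    (here o)          = castᵀ-nm e o
  castᴸ-nm (Perm.prep e es)    (there o)         = castᴸ-nm es o
  castᴸ-nm (Perm.swap e e′ es) (here o)          = castᵀ-nm e o
  castᴸ-nm (Perm.swap e e′ es) (there (here o))  = castᵀ-nm e′ o
  castᴸ-nm (Perm.swap e e′ es) (there (there o)) = castᴸ-nm es o
  castᴸ-nm (Perm.trans es es′) o = trans (castᴸ-nm es′ (castᴸ es o)) (castᴸ-nm es o)

  castᵂ-nm (e ∷ es) (here o)  = castᵀ-nm e o
  castᵂ-nm (e ∷ es) (there o) = castᵂ-nm es o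

  ++⁺ˡ-nm : ∀ {As Bs} (o : Any Occᵀ As) → nmᴸ (++⁺ˡ {ys = Bs} o) ≡ nmᴸ o
  ++⁺ˡ-nm (here o)  = refl
  ++⁺ˡ-nm (there o) = ++⁺ˡ-nm o

  ++⁺ʳ-nm : ∀ As {Bs} (o : Any Occᵀ Bs) → nmᴸ (++⁺ʳ As o) ≡ nmᴸ o
  ++⁺ʳ-nm []       o = refl
  ++⁺ʳ-nm (A ∷ As) o = ++⁺ʳ-nm As o

  fromˡ-nm : ∀ {P Q R} (s : P ⊎ Q ≔ R) o → nmᴾ (fromˡ s o) ≡ nmᴾ o
  fromˡ-nm ground o       = refl
  fromˡ-nm bag    (bag o) = ++⁺ˡ-nm o

  fromʳ-nm : ∀ {P Q R} (s : P ⊎ Q ≔ R) o → nmᴾ (fromʳ s o) ≡ nmᴾ o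
  fromʳ-nm ground     o       = refl
  fromʳ-nm (bag {As}) (bag o) = ++⁺ʳ-nm As o

  fromDrop-nm : ∀ P o → nmᴾ (fromDrop P o) ≡ nmᴾ o
  fromDrop-nm (ground L) o        = refl
  fromDrop-nm (bag As)   (bag ())

  ctx!-nm : {πs : Γ ⊢! t ∶ As} {ρ : Δ ⊢ t ∶ B} (i : Premise! πs ρ) → ∀ x o →
            nmᴾ (ctx! i x o) ≡ nmᴾ o
  ctx!-nm (head {s = s})   x o = fromˡ-nm (s x) o
  ctx!-nm (next {s = s} i) x o = trans (fromʳ-nm (s x) (ctx! i x o)) (ctx!-nm i x o)

  subj!-nm : {πs : Γ ⊢! t ∶ As} {ρ : Δ ⊢ t ∶ B} (i : Premise! πs ρ) → ∀ o →
             nmᴸ (subj! i o) ≡ nmᵀ o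
  subj!-nm head     o = refl
  subj!-nm (next i) o = subj!-nm i o

  corr-nm : {π : Γ ⊢ t ∶ A} {ρ : Δ ⊢ u ∶ B} {i : Premise π ρ} → ∀ {o′ o} →
            Corr i o′ o → nmᴼ o′ ≡ nmᴼ o
  corr-nm (let₁ {s = s} x o)  = sym (fromˡ-nm (s x) o)
  corr-nm (let₂ {s = s} x o)  = sym (fromʳ-nm (s x) o)
  corr-nm (let₂ˢ o)           = refl
  corr-nm (pair₁ x o)         = refl
  corr-nm (pair₁ˢ o)          = refl
  corr-nm (pair₂ x o)         = refl
  corr-nm (pair₂ˢ o)          = refl
  corr-nm (letp₁ {Γ = Γ} x o) = sym (fromDrop-nm (Γ x) o)
  corr-nm (letp₂ x o)         = refl
  corr-nm (letp₂ˢ o)          = refl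
  corr-nm (abs x o)           = refl
  corr-nm (absᵛ o)            = refl
  corr-nm (absˢ o)            = refl
  corr-nm (app₁ {s = s} x o)  = sym (fromˡ-nm (s x) o)
  corr-nm (app₁ˢ o)           = refl
  corr-nm (app₂ {s = s} x o)  = sym (fromʳ-nm (s x) o)
  corr-nm (bang {i = i} x o)  = sym (ctx!-nm i x o)
  corr-nm (bangˢ {i = i} o)   = sym (subj!-nm i o)
  corr-nm (der x o)           = refl
  corr-nm (derˢ o)            = refl

  cut-nm : {π : Γ ⊢ t ∶ A} {ρ : Δ ⊢ u ∶ B} {ρ′ : Δ′ ⊢ u′ ∶ B′}
           {i : Premise π ρ} {j : Premise π ρ′} → ∀ {o o′} →
           Cut i o j o′ → nmᴼ o ≡ nmᴼ o′
  cut-nm (let-in {e = e} o) = sym (castᴾ-nm e o)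
  cut-nm (app {e = e} o)    = sym (castᴾ-nm e o)
  cut-nm (letpˡ o)          = refl
  cut-nm (letpʳ o)          = refl

  ∈-axioms! : {πs : Γ ⊢! t ∶ As} {ρ : Δ ⊢ t ∶ B} → Premise! πs ρ →
              ∀ {α} → Any (α ≡_) (axioms ρ) → Any (α ≡_) (axioms! πs)
  ∈-axioms! head               p = ∈-++⁺ˡ p
  ∈-axioms! (next {π = π} i)   p = ∈-++⁺ʳ (axioms π) (∈-axioms! i p)

  ∈-axioms : {π : Γ ⊢ t ∶ A} {ρ : Δ ⊢ u ∶ B} → Premise π ρ →
             ∀ {α} → Any (α ≡_) (axioms ρ) → Any (α ≡_) (axioms π)
  ∈-axioms let₁              p = ∈-++⁺ˡ p
  ∈-axioms (let₂ {π₁ = π₁})  p = ∈-++⁺ʳ (axioms π₁) p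
  ∈-axioms pair₁             p = ∈-++⁺ˡ p
  ∈-axioms (pair₂ {π₁ = π₁}) p = ∈-++⁺ʳ (axioms π₁) p
  ∈-axioms letp₁             p = ∈-++⁺ˡ p
  ∈-axioms (letp₂ {π₁ = π₁}) p = ∈-++⁺ʳ (axioms π₁) p
  ∈-axioms abs₁              p = p
  ∈-axioms app₁              p = ∈-++⁺ˡ p
  ∈-axioms (app₂ {π₁ = π₁})  p = ∈-++⁺ʳ (axioms π₁) p
  ∈-axioms (bang i)          p = ∈-axioms! i p
  ∈-axioms der₁              p = p

  HasParent : List Axiom → Rel Name ℓ
  HasParent αs Y X = Σ[ α ∈ Axiom ] (Any (α ≡_) αs × Y ∈ parents α × main α ≡ X)

  atom-nm : ∀ {P Y} → P ≡ ground (name Y) → (o : Occᴾ P) → nmᴾ o ≡ Y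
  atom-nm refl (ground name) = refl

  flow-nm : {π : Γ ⊢ t ∶ A} {p q : Position π} → Flow π p q →
            nm p ≡ nm q ⊎ HasParent (axioms π) (nm p) (nm q)
  flow-nm (cond {Ys = Ys} {typed = typed} i o) =
    inj₂ (_ , here refl , subst (_∈ _) (sym (atom-nm (typed i) o)) (lookup-∈ Ys i) , refl)
  flow-nm (var→ _)   = inj₁ refl
  flow-nm (var← _)   = inj₁ refl
  flow-nm (cut→ c _) = inj₁ (cut-nm c)
  flow-nm (cut← c _) = inj₁ (sym (cut-nm c))
  flow-nm (up c _)   = inj₁ (sym (corr-nm c))
  flow-nm (down c _) = inj₁ (corr-nm c)
  flow-nm (inside {i = i} f) with flow-nm f
  ... | inj₁ e               = inj₁ e
  ... | inj₂ (α , α∈ , rest) = inj₂ (α , ∈-axioms i α∈ , rest)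

  collapse⇒parent : {π : Γ ⊢ t ∶ A} → ∀ {Y X} → Collapse π Y X → HasParent (axioms π) Y X
  collapse⇒parent (Y≢X , _ , _ , f , refl , refl) with flow-nm f
  ... | inj₁ e = contradiction e Y≢X
  ... | inj₂ h = h

  FlowBetween : Γ ⊢ t ∶ A → Rel Name ℓ
  FlowBetween π Y X =
    Σ[ p ∈ Position π ] Σ[ q ∈ Position π ] (Flow π p q × nm p ≡ Y × nm q ≡ X)

  within : {π : Γ ⊢ t ∶ A} {ρ : Δ ⊢ u ∶ B} → Premise π ρ →
           ∀ {Y X} → FlowBetween ρ Y X → FlowBetween π Y X
  within i (p , q , f , e , e′) = there i p , there i q , inside f , e , e′

  atom-occ : ∀ {P Y} → P ≡ ground (name Y) → Σ[ o ∈ Occᴾ P ] nmᴾ o ≡ Y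
  atom-occ refl = ground name , refl

  toList-lookup : ∀ {k} (Ys : Vec Name k) {Y} → Y ∈ Vec.toList Ys →
                  Σ[ i ∈ Fin k ] Vec.lookup Ys i ≡ Y
  toList-lookup (Y ∷ Ys) (here e)  = zero , sym e
  toList-lookup (_ ∷ Ys) (there p) with toList-lookup Ys p
  ... | i , e = suc i , e

  parent⇒flow : (π : Γ ⊢ t ∶ A) → ∀ {α Y} → Any (α ≡_) (axioms π) → Y ∈ parents α →
                FlowBetween π Y (main α)
  parent⇒flow! : (πs : Γ ⊢! t ∶ As) → ∀ {α Y} → Any (α ≡_) (axioms! πs) → Y ∈ parents α →
                 Σ[ Δ ∈ Ctx _ ] Σ[ B ∈ Ty ] Σ[ ρ ∈ (Δ ⊢ t ∶ B) ]
                   (Premise! πs ρ × FlowBetween ρ Y (main α))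

  parent⇒flow (sample _ _) (here refl) ()
  parent⇒flow (cond ys Ys d _ _ typed _ _) (here refl) Y∈ with toList-lookup Ys Y∈
  ... | i , refl with atom-occ (typed i)
  ... | o , e = here (ctx (Vec.lookup ys i) o) , here (subj (pos (ground name)))
              , cond i o , e , refl
  parent⇒flow (let-in _ _ π₁ π₂) α∈ Y∈ with ∈-++⁻ (axioms π₁) α∈
  ... | inj₁ α∈₁ = within let₁ (parent⇒flow π₁ α∈₁ Y∈)
  ... | inj₂ α∈₂ = within let₂ (parent⇒flow π₂ α∈₂ Y∈)
  parent⇒flow (pair _ π₁ π₂) α∈ Y∈ with ∈-++⁻ (axioms π₁) α∈
  ... | inj₁ α∈₁ = within pair₁ (parent⇒flow π₁ α∈₁ Y∈)
  ... | inj₂ α∈₂ = within pair₂ (parent⇒flow π₂ α∈₂ Y∈)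
  parent⇒flow (letp-in π₁ π₂) α∈ Y∈ with ∈-++⁻ (axioms π₁) α∈
  ... | inj₁ α∈₁ = within letp₁ (parent⇒flow π₁ α∈₁ Y∈)
  ... | inj₂ α∈₂ = within letp₂ (parent⇒flow π₂ α∈₂ Y∈)
  parent⇒flow (abs π) α∈ Y∈ = within abs₁ (parent⇒flow π α∈ Y∈)
  parent⇒flow (app _ _ π₁ π₂) α∈ Y∈ with ∈-++⁻ (axioms π₁) α∈
  ... | inj₁ α∈₁ = within app₁ (parent⇒flow π₁ α∈₁ Y∈)
  ... | inj₂ α∈₂ = within app₂ (parent⇒flow π₂ α∈₂ Y∈)
  parent⇒flow (bang πs) α∈ Y∈ with parent⇒flow! πs α∈ Y∈
  ... | _ , _ , _ , i , f = within (bang i) f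
  parent⇒flow (der π) α∈ Y∈ = within der₁ (parent⇒flow π α∈ Y∈)

  parent⇒flow! (add _ π πs) α∈ Y∈ with ∈-++⁻ (axioms π) α∈
  ... | inj₁ α∈₁ = _ , _ , π , head , parent⇒flow π α∈₁ Y∈
  ... | inj₂ α∈₂ with parent⇒flow! πs α∈₂ Y∈
  ...   | _ , _ , ρ , i , f = _ , _ , ρ , next i , f

  nmᴳ-∈ : ∀ {L} (o : Occᴳ L) → nmᴳ o ∈ namesᴳ L
  nmᴳ-∈ name              = here refl
  nmᴳ-∈ (left o)          = ∈-++⁺ˡ (nmᴳ-∈ o)
  nmᴳ-∈ (right {K = K} o) = ∈-++⁺ʳ (namesᴳ K) (nmᴳ-∈ o)

  nmᴾ-∈ : ∀ {P} (o : Occᴾ P) → nmᴾ o ∈ namesᴾ P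
  nmᴸ-∈ : ∀ {As} (o : Any Occᵀ As) → nmᴸ o ∈ namesᴸ As
  nmᵀ-∈ : ∀ {A} (o : Occᵀ A) → nmᵀ o ∈ namesᵀ A

  nmᴾ-∈ (ground o) = nmᴳ-∈ o
  nmᴾ-∈ (bag o)    = nmᴸ-∈ o

  nmᴸ-∈ (here o)          = ∈-++⁺ˡ (nmᵀ-∈ o)
  nmᴸ-∈ (there {x = A} o) = ∈-++⁺ʳ (namesᵀ A) (nmᴸ-∈ o)

  nmᵀ-∈ (pos o)         = nmᴾ-∈ o
  nmᵀ-∈ (dom o)         = ∈-++⁺ˡ (nmᴾ-∈ o)
  nmᵀ-∈ (cod {P = P} o) = ∈-++⁺ʳ (namesᴾ P) (nmᵀ-∈ o)

  nmᴼ-∈ : (o : Occ Γ A) → nmᴼ o ∈ namesᴶ Γ A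
  nmᴼ-∈ {Γ = Γ} (ctx x o) = ∈-++⁺ˡ (namesᶜ-∈ Γ x (nmᴾ-∈ o))
  nmᴼ-∈ {Γ = Γ} (subj o)  = ∈-++⁺ʳ (namesᶜ Γ) (nmᵀ-∈ o)

  ∈-names! : {πs : Γ ⊢! t ∶ As} {ρ : Δ ⊢ t ∶ B} → Premise! πs ρ →
             ∀ {X} → X ∈ names ρ → X ∈ names! πs
  ∈-names! head             p = ∈-++⁺ˡ p
  ∈-names! (next {π = π} i) p = ∈-++⁺ʳ (names π) (∈-names! i p)

  ∈-names⁻ : {π : Γ ⊢ t ∶ A} {ρ : Δ ⊢ u ∶ B} → Premise π ρ →
             ∀ {X} → X ∈ names ρ → X ∈ names⁻ π
  ∈-names⁻ let₁              p = ∈-++⁺ˡ p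
  ∈-names⁻ (let₂ {π₁ = π₁})  p = ∈-++⁺ʳ (names π₁) p
  ∈-names⁻ pair₁             p = ∈-++⁺ˡ p
  ∈-names⁻ (pair₂ {π₁ = π₁}) p = ∈-++⁺ʳ (names π₁) p
  ∈-names⁻ letp₁             p = ∈-++⁺ˡ p
  ∈-names⁻ (letp₂ {π₁ = π₁}) p = ∈-++⁺ʳ (names π₁) p
  ∈-names⁻ abs₁              p = p
  ∈-names⁻ app₁              p = ∈-++⁺ˡ p
  ∈-names⁻ (app₂ {π₁ = π₁})  p = ∈-++⁺ʳ (names π₁) p
  ∈-names⁻ (bang i)          p = ∈-names! i p
  ∈-names⁻ der₁              p = p

  nm-∈ : {π : Γ ⊢ t ∶ A} (p : Position π) → nm p ∈ names π
  nm-∈ (here o)                      = ∈-++⁺ˡ (nmᴼ-∈ o)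
  nm-∈ {Γ = Γ} {A = A} (there i p) = ∈-++⁺ʳ (namesᶜ Γ ++ namesᵀ A) (∈-names⁻ i (nm-∈ p))

  -- Realizability shows that a predicate closed under the probabilistic axioms
  -- holds of every name of a closed derivation of ground type.  Applied to "is a
  -- main name and is accessible in the collapsed flow graph" it yields that the
  -- extracted network is well defined.  A realizer in R A φ proves φ once it has
  -- been used up: ground types at once, multisets when all their elements are,
  -- arrows when they are applied.

  module Realizability (p : Name → Set ℓ) where

    Rᴾ : Positive → Set ℓ → Set (lsuc ℓ)
    Rᴸ : List Ty → Set ℓ → Set (lsuc ℓ)
    Rᵀ : Ty → Set ℓ → Set (lsuc ℓ)

    Rᴾ (ground L) φ = Lift (lsuc ℓ) (φ × All p (namesᴳ L))
    Rᴾ (bag As)   φ = Rᴸ As φ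

    Rᴸ []       φ = Lift (lsuc ℓ) φ
    Rᴸ (A ∷ As) φ = Σ[ ψ ∈ Set ℓ ] Σ[ χ ∈ Set ℓ ] ((ψ × χ → φ) × Rᵀ A ψ × Rᴸ As χ)

    Rᵀ (pos P) φ = Rᴾ P φ
    Rᵀ (P ⊸ A) φ = ∀ ψ → Rᴾ P ψ → Rᵀ A (φ × ψ)

    private
      variable
        φ ψ : Set ℓ

    mapᴾ : ∀ P → (φ → ψ) → Rᴾ P φ → Rᴾ P ψ
    mapᴸ : ∀ As → (φ → ψ) → Rᴸ As φ → Rᴸ As ψ
    mapᵀ : ∀ A → (φ → ψ) → Rᵀ A φ → Rᵀ A ψ

    mapᴾ (ground L) f (lift (a , b)) = lift (f a , b)
    mapᴾ (bag As)   f r              = mapᴸ As f r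

    mapᴸ []       f (lift a)          = lift (f a)
    mapᴸ (A ∷ As) f (_ , _ , h , rest) = _ , _ , f ∘ h , rest

    mapᵀ (pos P) f r = mapᴾ P f r
    mapᵀ (P ⊸ A) f r = λ χ a → mapᵀ A (λ (x , y) → f x , y) (r χ a)

    certifyᴾ : ∀ P → Rᴾ P φ → Rᴾ P (φ × All p (namesᴾ P))
    certifyᴸ : ∀ As → Rᴸ As φ → Rᴸ As (φ × All p (namesᴸ As))
    certifyᵀ : ∀ A → Rᵀ A φ → Rᵀ A (φ × All p (namesᵀ A))

    certifyᴾ (ground L) (lift (a , b)) = lift ((a , b) , b)
    certifyᴾ (bag As)   r              = certifyᴸ As r

    certifyᴸ []       (lift a)             = lift (a , [])
    certifyᴸ (A ∷ As) (_ , _ , h , a , as) =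
      _ , _ , (λ ((x , xs) , (y , ys)) → h (x , y) , AllP.++⁺ xs ys)
      , certifyᵀ A a , certifyᴸ As as

    certifyᵀ (pos P) r = certifyᴾ P r
    certifyᵀ (P ⊸ A) r = λ ψ a →
      mapᵀ A (λ ((x , (y , ys)) , zs) → (x , AllP.++⁺ ys zs) , y)
             (certifyᵀ A (r _ (certifyᴾ P a)))

    convᴾ  : ∀ {P Q} → P ≅ᴾ Q → Rᴾ P φ → Rᴾ Q φ
    convᴾ⁻ : ∀ {P Q} → P ≅ᴾ Q → Rᴾ Q φ → Rᴾ P φ
    convᴸ  : ∀ {As Bs} → Permutation _≅ᵀ_ As Bs → Rᴸ As φ → Rᴸ Bs φ
    convᴸ⁻ : ∀ {As Bs} → Permutation _≅ᵀ_ As Bs → Rᴸ Bs φ → Rᴸ As φ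
    convᵂ  : ∀ {As Bs} → Pointwise _≅ᵀ_ As Bs → Rᴸ As φ → Rᴸ Bs φ
    convᵂ⁻ : ∀ {As Bs} → Pointwise _≅ᵀ_ As Bs → Rᴸ Bs φ → Rᴸ As φ
    convᵀ  : ∀ {A B} → A ≅ᵀ B → Rᵀ A φ → Rᵀ B φ
    convᵀ⁻ : ∀ {A B} → A ≅ᵀ B → Rᵀ B φ → Rᵀ A φ

    convᴾ  ground  r = r
    convᴾ  (bag e) r = convᴸ e r
    convᴾ⁻ ground  r = r
    convᴾ⁻ (bag e) r = convᴸ⁻ e r

    convᴸ (Perm.refl es)      r = convᵂ es r
    convᴸ (Perm.prep e es)    (_ , _ , h , a , as) = _ , _ , h , convᵀ e a , convᴸ es as
    convᴸ (Perm.swap e e′ es) (_ , _ , h , a , _ , _ , h′ , b , as) =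
      _ , _ , (λ (y , x , z) → h (x , h′ (y , z))) , convᵀ e′ b
      , _ , _ , id , convᵀ e a , convᴸ es as
    convᴸ (Perm.trans es es′) r = convᴸ es′ (convᴸ es r)

    convᴸ⁻ (Perm.refl es)      r = convᵂ⁻ es r
    convᴸ⁻ (Perm.prep e es)    (_ , _ , h , a , as) = _ , _ , h , convᵀ⁻ e a , convᴸ⁻ es as
    convᴸ⁻ (Perm.swap e e′ es) (_ , _ , h , b , _ , _ , h′ , a , as) =
      _ , _ , (λ (y , x , z) → h (x , h′ (y , z))) , convᵀ⁻ e a
      , _ , _ , id , convᵀ⁻ e′ b , convᴸ⁻ es as
    convᴸ⁻ (Perm.trans es es′) r = convᴸ⁻ es (convᴸ⁻ es′ r)

    convᵂ  []       r                    = r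
    convᵂ  (e ∷ es) (_ , _ , h , a , as) = _ , _ , h , convᵀ e a , convᵂ es as
    convᵂ⁻ []       r                    = r
    convᵂ⁻ (e ∷ es) (_ , _ , h , a , as) = _ , _ , h , convᵀ⁻ e a , convᵂ⁻ es as

    convᵀ  (pos e)  r = convᴾ e r
    convᵀ  (e ⊸ e′) r = λ ψ a → convᵀ e′ (r ψ (convᴾ⁻ e a))
    convᵀ⁻ (pos e)  r = convᴾ⁻ e r
    convᵀ⁻ (e ⊸ e′) r = λ ψ a → convᵀ⁻ e′ (r ψ (convᴾ e a))

    splitᴸ : ∀ As {Bs} → Rᴸ (As ++ Bs) φ →
             Σ[ ψ ∈ Set ℓ ] Σ[ χ ∈ Set ℓ ] ((ψ × χ → φ) × Rᴸ As ψ × Rᴸ Bs χ)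
    splitᴸ []       r = ⊤ , _ , proj₂ , lift tt , r
    splitᴸ (A ∷ As) (_ , _ , h , a , as) with splitᴸ As as
    ... | _ , _ , h′ , l , r =
      _ , _ , (λ ((x , y) , z) → h (x , h′ (y , z))) , (_ , _ , id , a , l) , r

    split : ∀ {P Q R} → P ⊎ Q ≔ R → Rᴾ R φ →
            Σ[ ψ ∈ Set ℓ ] Σ[ χ ∈ Set ℓ ] ((ψ × χ → φ) × Rᴾ P ψ × Rᴾ Q χ)
    split {φ = φ} ground r = φ , φ , proj₁ , r , r
    split (bag {As})     r = splitᴸ As r

    Env : Ctx n → (Fin n → Set ℓ) → Set (lsuc ℓ)
    Env Γ φ = ∀ x → Rᴾ (Γ x) (φ x)

    splitEnv : {φ : Fin n → Set ℓ} → Γ₁ ⊎ᶜ Γ₂ ≔ Γ → Env Γ φ →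
               Σ[ ψ ∈ (Fin n → Set ℓ) ] Σ[ χ ∈ (Fin n → Set ℓ) ]
                 ((∀ x → ψ x × χ x → φ x) × Env Γ₁ ψ × Env Γ₂ χ)
    splitEnv s η =
      (λ x → proj₁ (r x)) , (λ x → proj₁ (proj₂ (r x))) , (λ x → proj₁ (proj₂ (proj₂ (r x))))
      , (λ x → proj₁ (proj₂ (proj₂ (proj₂ (r x)))))
      , (λ x → proj₂ (proj₂ (proj₂ (proj₂ (r x)))))
      where r = λ x → split (s x) (η x)

    extend : {φ : Fin n → Set ℓ} → Rᴾ P ψ → Env Γ φ → Env (P ◂ Γ) (ψ Fun.∷ φ)
    extend r η zero    = r
    extend r η (suc x) = η x

    discard : ∀ {P} → GroundOrEmpty P → Rᴾ P φ → φ
    discard ground (lift (a , _)) = a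
    discard empty  (lift a)       = a

    keep : Positive → Set ℓ → Set ℓ
    keep (ground L) φ = φ
    keep (bag As)   φ = ⊤

    dropEnv : ∀ P → Rᴾ P φ → Rᴾ (dropBag P) (keep P φ)
    dropEnv (ground L) r = r
    dropEnv (bag As)   r = lift tt

    atom-holds : ∀ {P Y} → P ≡ ground (name Y) → Rᴾ P φ → p Y
    atom-holds refl (lift (_ , h ∷ [])) = h

    all-toList : ∀ {k} (Ys : Vec Name k) → (∀ i → p (Vec.lookup Ys i)) → All p (Vec.toList Ys)
    all-toList []       h = []
    all-toList (Y ∷ Ys) h = h zero ∷ all-toList Ys (h ∘ suc)

    Closed : List Axiom → Set ℓ
    Closed αs = All (λ α → All p (parents α) → p (main α)) αs

    all-namesᶜ : (Γ : Ctx n) → (∀ x → All p (namesᴾ (Γ x))) → All p (namesᶜ Γ)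
    all-namesᶜ Γ h = AllP.concat⁺ (AllP.tabulate⁺ h)

    realize  : (π : Γ ⊢ t ∶ A) → Closed (axioms π) → {φ : Fin _ → Set ℓ} → Env Γ φ →
               Rᵀ A ((∀ x → φ x) × All p (names π))
    realize⁻ : (π : Γ ⊢ t ∶ A) → Closed (axioms π) → {φ : Fin _ → Set ℓ} → Env Γ φ →
               Rᵀ A ((∀ x → φ x) × All p (names⁻ π))
    realize! : (πs : Γ ⊢! t ∶ As) → Closed (axioms! πs) → {φ : Fin _ → Set ℓ} → Env Γ φ →
               Rᴸ As ((∀ x → φ x) × All p (names! πs))

    realize {Γ = Γ} {A = A} π cl η =
      mapᵀ A (λ ((f , ns) , a) → (λ x → proj₁ (f x))
                               , AllP.++⁺ (AllP.++⁺ (all-namesᶜ Γ (λ x → proj₂ (f x))) a) ns)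
             (certifyᵀ A (realize⁻ π cl (λ x → certifyᴾ (Γ x) (η x))))

    realize⁻ (sample g _) (c ∷ []) η =
      lift (((λ x → discard (g x) (η x)) , []) , c [] ∷ [])
    realize⁻ (cond ys Ys _ _ _ typed g _) (c ∷ []) η =
      lift (((λ x → discard (g x) (η x)) , [])
           , c (all-toList Ys (λ i → atom-holds (typed i) (η (Vec.lookup ys i)))) ∷ [])
    realize⁻ {Γ = Γ} (var x g) [] {φ} η = mapᴾ (Γ x) (λ a → all a , []) (η x)
      where
      all : φ x → ∀ y → φ y
      all a y with y Fin.≟ x
      ... | yes refl = a
      ... | no y≢x   = discard (g y y≢x) (η y)
    realize⁻ {A = A} (let-in s e π₁ π₂) cl η =
      let c₁ , c₂ = AllP.++⁻ (axioms π₁) cl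
          _ , _ , join , η₁ , η₂ = splitEnv s η
      in mapᵀ A (λ (f , ns) → (λ x → join x (proj₁ (f zero) x , f (suc x)))
                         , AllP.++⁺ (proj₂ (f zero)) ns)
             (realize π₂ c₂ (extend (convᴾ e (realize π₁ c₁ η₁)) η₂))
    realize⁻ (pair _ π₁ π₂) cl η =
      let c₁ , c₂ = AllP.++⁻ (axioms π₁) cl
          lift ((f , ns₁) , l₁) = realize π₁ c₁ η
          lift ((_ , ns₂) , l₂) = realize π₂ c₂ η
      in lift ((f , AllP.++⁺ ns₁ ns₂) , AllP.++⁺ l₁ l₂)
    realize⁻ {Γ = Γ} {A = A} (letp-in {L₁ = L₁} π₁ π₂) cl η =
      let c₁ , c₂ = AllP.++⁻ (axioms π₁) cl
          lift ((_ , ns₁) , l) = realize π₁ c₁ (λ x → dropEnv (Γ x) (η x))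
          l₁ , l₂ = AllP.++⁻ (namesᴳ L₁) l
      in mapᵀ A (λ (f , ns) → (λ x → f (suc (suc x))) , AllP.++⁺ ns₁ ns)
             (realize π₂ c₂ (extend {ψ = ⊤} (lift (tt , l₂))
                                    (extend {ψ = ⊤} (lift (tt , l₁)) η)))
    realize⁻ (abs {A = A} π) cl η = λ ψ a →
      mapᵀ A (λ (f , ns) → ((λ x → f (suc x)) , ns) , f zero) (realize π cl (extend a η))
    realize⁻ {A = A} (app s e π₁ π₂) cl η =
      let c₁ , c₂ = AllP.++⁻ (axioms π₁) cl
          _ , _ , join , η₁ , η₂ = splitEnv s η
      in mapᵀ A (λ ((f₁ , ns₁) , (f₂ , ns₂)) → (λ x → join x (f₁ x , f₂ x)) , AllP.++⁺ ns₁ ns₂)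
             (realize π₁ c₁ η₁ _ (convᴾ⁻ e (realize π₂ c₂ η₂)))
    realize⁻ (bang πs) cl η = realize! πs cl η
    realize⁻ {A = A} (der π) cl η with realize π cl η
    ... | _ , _ , h , a , lift b = mapᵀ A (λ x → h (x , b)) a

    realize! ([] g) [] η = lift ((λ x → discard (g x) (η x)) , [])
    realize! (add s π πs) cl η =
      let c₁ , c₂ = AllP.++⁻ (axioms π) cl
          _ , _ , join , η₁ , η₂ = splitEnv s η
      in _ , _ , (λ ((f₁ , ns₁) , (f₂ , ns₂)) → (λ x → join x (f₁ x , f₂ x)) , AllP.++⁺ ns₁ ns₂)
      , realize π c₁ η₁ , realize! πs c₂ η₂

    all-names : ∀ {t L} (π : ∙ ⊢ t ∶ pos (ground L)) → Closed (axioms π) → All p (names π)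
    all-names π cl with realize π cl {λ ()} (λ ())
    ... | lift ((_ , ns) , _) = ns

  glue-∈ : ∀ {𝕏 ℤ} (z̄ : Val ℤ) (ȳ : Val (𝕏 ∖ ℤ)) {X} .(p : X ∈ˢ 𝕏) (q : X ∈ˢ ℤ) →
           glue {𝕏} {ℤ} z̄ ȳ X p ≡ z̄ X q
  glue-∈ {ℤ = ℤ} z̄ ȳ {X} p q with X ∈? elems ℤ
  ... | yes _ = refl
  ... | no ¬q = contradiction q ¬q

  glue-∉ : ∀ {𝕏 ℤ} (z̄ : Val ℤ) (ȳ : Val (𝕏 ∖ ℤ)) {X} .(p : X ∈ˢ 𝕏) (¬q : ¬ X ∈ˢ ℤ) →
           glue {𝕏} {ℤ} z̄ ȳ X p ≡ ȳ X (∖-⁺ 𝕏 ℤ p ¬q)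
  glue-∉ {ℤ = ℤ} z̄ ȳ {X} p ¬q with X ∈? elems ℤ
  ... | yes q = contradiction q ¬q
  ... | no _  = refl

  cons-head : ∀ {X Xs} b (z̄ : ValOn Xs) .(p : X ∈ X ∷ Xs) → cons {X} b z̄ X p ≡ b
  cons-head {X} b z̄ p with X ≟ X
  ... | yes _  = refl
  ... | no X≢X = contradiction refl X≢X

  factor-⊇ : ∀ α {Y} → Y ≡ main α ⊎ Y ∈ parents α → Y ∈ˢ Nmᶠ (factor α)
  factor-⊇ (sample X d)    (inj₁ refl) = here refl
  factor-⊇ (cond Ys X _ d) (inj₁ refl) =
    ∪-⁺ʳ (fromList (Vec.toList Ys)) ⁅ X ⁆ (here refl)
  factor-⊇ (cond Ys X _ d) (inj₂ p) =
    ∪-⁺ˡ (fromList (Vec.toList Ys)) ⁅ X ⁆ (∈-fromList⁺ p)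

  factor-⊆ : ∀ α {Y} → Y ∈ˢ Nmᶠ (factor α) → Y ≡ main α ⊎ Y ∈ parents α
  factor-⊆ (sample X d) (here e) = inj₁ e
  factor-⊆ (cond Ys X _ d) p with ∪-⁻ (fromList (Vec.toList Ys)) ⁅ X ⁆ p
  ... | inj₁ q        = inj₂ (∈-fromList⁻ (Vec.toList Ys) q)
  ... | inj₂ (here e) = inj₁ e

  parent≢main : ∀ α {Y} → Y ∈ parents α → Y ≢ main α
  parent≢main (cond Ys X X∉ d) p refl = X∉ p

  prob≤1 : ∀ d b → Dist.prob d b ≤ 1#
  prob≤1 d b = ≤.trans (≤.reflexive (≈-sym (+-identityʳ _)))
                 (≤.trans (+-mono-≤ ≤.refl (Dist.nonneg d (not b))) (≤.reflexive (sums b)))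
    where
    open Dist d
    sums : ∀ b → prob b + prob (not b) ≈ 1#
    sums true  = total
    sums false = ≈-trans (+-comm _ _) total

  factor≤1 : ∀ α x̄ → evalᶠ (factor α) x̄ ≤ 1#
  factor≤1 (sample X d)    x̄ = prob≤1 d _
  factor≤1 (cond Ys X _ d) x̄ = prob≤1 (d _) _

  sum-total : ∀ d {a b} → a ≈ Dist.prob d true → b ≈ Dist.prob d false → a + (b + 0#) ≈ 1#
  sum-total d e e′ = ≈-trans (+-cong e (≈-trans (+-identityʳ _) e′)) (Dist.total d)

  factor-total : ∀ α .(i : ⁅ main α ⁆ ⊆ˢ Nmᶠ (factor α)) ȳ →
                 evalᶠ (sumOut ⁅ main α ⁆ (factor α) i) ȳ ≈ 1#
  factor-total (sample X d) _ ȳ = sum-total d (at true) (at false)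
    where
    at : ∀ b → Dist.prob d (glue {⁅ X ⁆} {⁅ X ⁆} (cons b (λ _ ())) ȳ X (here refl)) ≈
               Dist.prob d b
    at b = reflexive (cong (Dist.prob d)
             (trans (glue-∈ {⁅ X ⁆} {⁅ X ⁆} (cons b (λ _ ())) ȳ {X} (here refl) (here refl))
                    (cons-head {X} b (λ _ ()) (here refl))))
  factor-total (cond Ys X X∉ d) _ ȳ = sum-total (d b̄) (at true) (at false)
    where
    𝕐 𝕏 : FinSet
    𝕐 = fromList (Vec.toList Ys)
    𝕏 = 𝕐 ∪ ⁅ X ⁆
    Y∈ : ∀ i → Vec.lookup Ys i ∈ˢ 𝕏
    Y∈ i = ∪-⁺ˡ 𝕐 ⁅ X ⁆ (∈-fromList⁺ (lookup-∈ Ys i))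
    X∈ : X ∈ˢ 𝕏
    X∈ = ∪-⁺ʳ 𝕐 ⁅ X ⁆ (here refl)
    Y∉ : ∀ i → ¬ Vec.lookup Ys i ∈ˢ ⁅ X ⁆
    Y∉ i (here e) = X∉ (subst (_∈ Vec.toList Ys) e (lookup-∈ Ys i))
    b̄ : Vec Bool _
    b̄ = Vec.tabulate λ i → ȳ (Vec.lookup Ys i) (∖-⁺ 𝕏 ⁅ X ⁆ (Y∈ i) (Y∉ i))
    z : Bool → Val ⁅ X ⁆
    z b = cons b (λ _ ())
    at : ∀ b → evalᶠ (factor (cond Ys X X∉ d)) (glue {𝕏} {⁅ X ⁆} (z b) ȳ) ≈ Dist.prob (d b̄) b
    at b = ≈-trans
      (reflexive (cong (λ c̄ → Dist.prob (d c̄) (glue {𝕏} {⁅ X ⁆} (z b) ȳ X X∈))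
                       (tabulate-cong λ i → glue-∉ {𝕏} {⁅ X ⁆} (z b) ȳ (Y∈ i) (Y∉ i))))
      (reflexive (cong (Dist.prob (d b̄))
        (trans (glue-∈ {𝕏} {⁅ X ⁆} (z b) ȳ X∈ (here refl)) (cons-head {X} b (λ _ ()) (here refl)))))

  unique-map : ∀ {a} {S : Set a} (f : S → Name) {xs} → Unique (map f xs) →
               ∀ {x y} → Any (x ≡_) xs → Any (y ≡_) xs → f x ≡ f y → x ≡ y
  unique-map f u        (here refl) (here refl) e = refl
  unique-map f (h ∷ _)  (here refl) (there q)   e =
    contradiction e (All.lookup h (∈-map⁺ f q))
  unique-map f (h ∷ _)  (there p)   (here refl) e =
    contradiction (sym e) (All.lookup h (∈-map⁺ f p))
  unique-map f (_ ∷ u)  (there p)   (there q)   e = unique-map f u p q e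

  module Extraction {t L} (π : Derivation ∙ t (pos (ground L))) where

    αs : List Axiom
    αs = axioms (tree π)

    infix 4 _⟶_
    _⟶_ : Rel Name ℓ
    _⟶_ = Collapse (tree π)

    parent-of : ∀ {α Y} → Any (α ≡_) αs → Y ⟶ main α → Y ∈ parents α
    parent-of α∈ e with collapse⇒parent e
    ... | α′ , α′∈ , Y∈ , m with unique-map main (naming π) α′∈ α∈ m
    ... | refl = Y∈

    Good : Name → Set ℓ
    Good X = Acc _⟶_ X × X ∈ map main αs

    good : ∀ {X} → X ∈ˢ Nm π → Good X
    good p = All.lookup (Realizability.all-names Good (tree π) (All.tabulate step))
                        (∈-fromList⁻ (names (tree π)) p)
      where
      step : ∀ {α} → Any (α ≡_) αs → All Good (parents α) → Good (main α)
      step α∈ h = acc (λ e → proj₁ (All.lookup h (parent-of α∈ e))) , ∈-map⁺ main α∈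

    axiom : ∀ {X} → X ∈ˢ Nm π → Σ[ α ∈ Axiom ] (Any (α ≡_) αs × X ≡ main α)
    axiom p = ∈-map⁻ main (proj₂ (good p))

    edge-∈ : ∀ {Y X} → Y ⟶ X → Y ∈ˢ Nm π × X ∈ˢ Nm π
    edge-∈ (_ , p , q , _ , refl , refl) = ∈-fromList⁺ (nm-∈ p) , ∈-fromList⁺ (nm-∈ q)

    acyclic : ∀ {X} → ¬ TransClosure _⟶_ X X
    acyclic c = acc⇒asym (accessible⁺ _⟶_ (proj₁ (good (source c)))) c c
      where
      source : ∀ {Y X} → TransClosure _⟶_ Y X → Y ∈ˢ Nm π
      source Trans.[ e ]   = proj₁ (edge-∈ e)
      source (e Trans.∷ _) = proj₁ (edge-∈ e)

    -- axiom p is the probabilistic axiom with main name X.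
    table : ∀ {X} → X ∈ˢ Nm π → Factor
    table p = factor (proj₁ (axiom p))

    Nm-⊇ : ∀ {X} (p : X ∈ˢ Nm π) → ∀ {Y} → Y ≡ X ⊎ Y ⟶ X → Y ∈ˢ Nmᶠ (table p)
    Nm-⊇ p h with axiom p
    ... | α , α∈ , refl = factor-⊇ α ([ inj₁ , inj₂ ∘ parent-of α∈ ]′ h)

    Nm-⊆ : ∀ {X} (p : X ∈ˢ Nm π) → ∀ {Y} → Y ∈ˢ Nmᶠ (table p) → Y ≡ X ⊎ Y ⟶ X
    Nm-⊆ p q with axiom p
    ... | α , α∈ , refl with factor-⊆ α q
    ...   | inj₁ e  = inj₁ e
    ...   | inj₂ Y∈ = inj₂ (parent≢main α Y∈ , parent⇒flow (tree π) α∈ Y∈)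

    total : ∀ {X} (p : X ∈ˢ Nm π) .(i : ⁅ X ⁆ ⊆ˢ Nmᶠ (table p)) ȳ →
            evalᶠ (sumOut ⁅ X ⁆ (table p) i) ȳ ≈ 1#
    total p i ȳ with axiom p
    ... | α , _ , refl = factor-total α i ȳ

  𝓑 : ∀ {t L} (π : Derivation ∙ t (pos (ground L))) → BayesianNetwork (Nm π)
  𝓑 π = record
    { _⟶_     = _⟶_
    ; edge-∈  = edge-∈
    ; acyclic = acyclic
    ; table   = table
    ; Nm-⊇    = Nm-⊇
    ; Nm-⊆    = Nm-⊆
    ; ≤1      = λ p x̄ → factor≤1 (proj₁ (axiom p)) x̄
    ; total   = λ p ȳ → total p (⁅⁆-⊆ (Nmᶠ (table p)) (Nm-⊇ p (inj₁ refl))) ȳ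
    }
    where open Extraction π

  ⨀-⊇ : ∀ {𝕏} (f : ∀ {X} → X ∈ 𝕏 → Factor) → (∀ {X} (p : X ∈ 𝕏) → X ∈ˢ Nmᶠ (f p)) →
         ∀ {X} → X ∈ 𝕏 → X ∈ˢ Nmᶠ (⨀ (mapWith∈ 𝕏 f))
  ⨀-⊇ {X ∷ 𝕏} f h (here refl) =
    ∪-⁺ˡ (Nmᶠ (f (here refl))) (Nmᶠ (⨀ (mapWith∈ 𝕏 (f ∘ there)))) (h (here refl))
  ⨀-⊇ {X ∷ 𝕏} f h (there p) =
    ∪-⁺ʳ (Nmᶠ (f (here refl))) (Nmᶠ (⨀ (mapWith∈ 𝕏 (f ∘ there)))) (⨀-⊇ (f ∘ there) (h ∘ there) p)

  ⟦⟧ᴮ-⊇ : ∀ {𝕏} (𝓑 : BayesianNetwork 𝕏) → 𝕏 ⊆ˢ Nmᶠ ⟦ 𝓑 ⟧ᴮ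
  ⟦⟧ᴮ-⊇ 𝓑 = ⨀-⊇ table (λ p → Nm-⊇ p (inj₁ refl))
    where open BayesianNetwork 𝓑

  marginal-⊆ : ∀ {t L} (π : Derivation ∙ t (pos (ground L))) →
               (Nm π ∖ Nmᴳ L) ⊆ˢ Nmᶠ ⟦ 𝓑 π ⟧ᴮ
  marginal-⊆ {L = L} π p = ⟦⟧ᴮ-⊇ (𝓑 π) (∖-⊆ (Nm π) (Nmᴳ L) p)

{-# OPTIONS --safe #-}

-- By realizability every name of π is a main name, so listing the axioms of π
-- by name, as the network does, merely permutes them: both sides marginalise
-- the same product.  That the orders of the factors and of the summed names do
-- not matter is checked on total valuations Name → Bool, where restriction to a
-- set of names is invisible.

module Submission where

open import Defs

open import Data.Bool.Base using (Bool; true; false)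
open import Data.List.Base using (List; []; _∷_; _++_; map)
open import Data.List.Membership.Propositional using (mapWith∈)
open import Data.List.Membership.Propositional.Properties
  using (∈-++⁺ˡ; ∈-++⁺ʳ; ∈-++⁻; ∈-filter⁻; map-mapWith∈; mapWith∈-cong; mapWith∈-id)
open import Data.List.Membership.Propositional.Properties.WithK using (unique∧set⇒bag)
open import Data.List.Properties using (++-assoc; map-++; map-∘)
open import Data.List.Relation.Binary.BagAndSetEquality using (∼bag⇒↭)
open import Data.List.Relation.Binary.Permutation.Propositional
  using (_↭_; refl; prep; swap; trans; ↭-sym; ↭-reflexive; ↭-trans)
open import Data.List.Relation.Binary.Permutation.Propositional.Properties using (map⁺; Any-resp-↭)
open import Data.List.Relation.Unary.Any using (Any; here; there; tail)
open import Data.List.Relation.Unary.Any.Properties using (mapWith∈⁺; mapWith∈⁻)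
open import Data.List.Relation.Unary.Unique.Propositional using (Unique)
import Data.List.Relation.Unary.Unique.Propositional.Properties as Unique
open import Data.Nat.Properties using (_≟_)
open import Data.List.Membership.DecPropositional _≟_ using (_∈_; _∈?_)
open import Data.Product.Base using (_,_; proj₁; proj₂)
open import Data.Sum.Base using (inj₁; inj₂)
open import Function.Base using (_∘_)
open import Function.Bundles using (mk⇔)
open import Relation.Binary.PropositionalEquality as ≡ using (_≡_; _≢_; _≗_; cong; subst)
open import Relation.Nullary using (¬_; Dec; yes; no; contradiction)
open import Relation.Nullary.Decidable using (¬?)
open import Relation.Nullary.Negation.Core using (contradiction-irr)
open import Algebra.Bundles using (CommutativeMonoid)
import Algebra.Properties.CommutativeSemigroup as CommutativeSemigroupProperties
import Relation.Binary.Reasoning.Setoid as SetoidReasoning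

-- Duplicate-free lists and set difference

-- Membership proofs in a duplicate-free list are unique, so equality as sets is already equality as
-- bags.
unique-↭ : ∀ {a} {S : Set a} {xs ys : List S} → Unique xs → Unique ys →
           (∀ {x} → Any (x ≡_) xs → Any (x ≡_) ys) →
           (∀ {x} → Any (x ≡_) ys → Any (x ≡_) xs) → xs ↭ ys
unique-↭ xs! ys! f g = ∼bag⇒↭ (unique∧set⇒bag xs! ys! (mk⇔ f g))

∖-∉ : ∀ 𝕏 𝕐 {X} → X ∈ˢ (𝕏 ∖ 𝕐) → ¬ X ∈ˢ 𝕐
∖-∉ 𝕏 𝕐 p = proj₂ (∈-filter⁻ (λ X → ¬? (X ∈? elems 𝕐)) {xs = elems 𝕏} p)

∖-monoˡ : ∀ 𝕏 𝕐 ℤ → 𝕏 ⊆ˢ 𝕐 → (𝕏 ∖ ℤ) ⊆ˢ (𝕐 ∖ ℤ)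
∖-monoˡ 𝕏 𝕐 ℤ 𝕏⊆𝕐 p = ∖-⁺ 𝕐 ℤ (𝕏⊆𝕐 (∖-⊆ 𝕏 ℤ p)) (∖-∉ 𝕏 ℤ p)

-- Total valuations: extension, overriding and assignment

-- The value true outside Xs is arbitrary.
totalAt : ∀ {Xs} → ValOn Xs → ∀ X → Dec (X ∈ Xs) → Bool
totalAt x̄ X (yes p) = x̄ X p
totalAt x̄ X (no _)  = true

totalise : ∀ {Xs} → ValOn Xs → Name → Bool
totalise {Xs} x̄ X = totalAt x̄ X (X ∈? Xs)

totalise-∈ : ∀ {Xs} (x̄ : ValOn Xs) X .(p : X ∈ Xs) → x̄ X p ≡ totalise x̄ X
totalise-∈ {Xs} x̄ X p with X ∈? Xs
... | yes _ = ≡.refl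
-- `p` is irrelevant, so it can only be used to refute this case.
... | no ¬p = contradiction-irr p ¬p

-- Counterpart of `glue` on total valuations: no ambient set of names has to contain `Y`.
overrideAt : ∀ {Xs} Y → Dec (Y ∈ Xs) → ValOn Xs → (Name → Bool) → Bool
overrideAt Y (yes p) z̄ σ = z̄ Y p
overrideAt Y (no _)  z̄ σ = σ Y

override : ∀ {Xs} → ValOn Xs → (Name → Bool) → Name → Bool
override {Xs} z̄ σ Y = overrideAt Y (Y ∈? Xs) z̄ σ

-- The decision is an argument so that congruence of assignment is a bare `cong`.
assignAt : ∀ {X Y : Name} → Dec (Y ≡ X) → Bool → Bool → Bool
assignAt (yes _) b c = b
assignAt (no _)  b c = c

infixl 9 _[_≔_]

_[_≔_] : (Name → Bool) → Name → Bool → Name → Bool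
(σ [ X ≔ b ]) Y = assignAt (Y ≟ X) b (σ Y)

assign-cong : ∀ {σ τ} X b → σ ≗ τ → σ [ X ≔ b ] ≗ τ [ X ≔ b ]
assign-cong X b e Y = cong (assignAt (Y ≟ X) b) (e Y)

assign-comm : ∀ {X Y} σ b c → X ≢ Y → σ [ X ≔ b ] [ Y ≔ c ] ≗ σ [ Y ≔ c ] [ X ≔ b ]
assign-comm {X} {Y} σ b c X≢Y Z with Z ≟ X | Z ≟ Y
... | yes ≡.refl | yes ≡.refl = contradiction ≡.refl X≢Y
... | yes _      | no _       = ≡.refl
... | no _       | yes _      = ≡.refl
... | no _       | no _       = ≡.refl

override-unique : ∀ {Xs} (z̄ : ValOn Xs) σ {τ} → (∀ Y .(p : Y ∈ Xs) → z̄ Y p ≡ τ Y) →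
                  (∀ Y → ¬ Y ∈ Xs → σ Y ≡ τ Y) → override z̄ σ ≗ τ
override-unique {Xs} z̄ σ h h′ Y with Y ∈? Xs
... | yes p = h Y p
... | no ¬p = h′ Y ¬p

-- The head of `cons` shadows any occurrence of `X` in `Xs`, and likewise the outermost assignment
-- wins.
override-cons : ∀ {X Xs} b (z̄ : ValOn Xs) σ →
                override (cons {X} b z̄) σ ≗ override z̄ σ [ X ≔ b ]
override-cons {X} {Xs} b z̄ σ = override-unique (cons b z̄) σ inside outside
  where
  inside : ∀ Y .(p : Y ∈ X ∷ Xs) → cons b z̄ Y p ≡ (override z̄ σ [ X ≔ b ]) Y
  inside Y p with Y ≟ X | Y ∈? Xs
  ... | yes _  | _     = ≡.refl
  ... | no _   | yes _ = ≡.refl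
  ... | no Y≢X | no ¬p = contradiction-irr (tail Y≢X p) ¬p
  outside : ∀ Y → ¬ Y ∈ X ∷ Xs → σ Y ≡ (override z̄ σ [ X ≔ b ]) Y
  outside Y ¬p with Y ≟ X | Y ∈? Xs
  ... | yes Y≡X | _     = contradiction (here Y≡X) ¬p
  ... | no _    | yes p = contradiction (there p) ¬p
  ... | no _    | no _  = ≡.refl

module _ {c ℓ₁ ℓ₂} (ℝ : OrderedCommutativeRing c ℓ₁ ℓ₂) where

  open OrderedCommutativeRing ℝ
  open Calculus ℝ
  open SetoidReasoning setoid
  private
    module + = CommutativeSemigroupProperties
                 (CommutativeMonoid.commutativeSemigroup +-commutativeMonoid)
    module × = CommutativeSemigroupProperties *-commutativeSemigroup

  -- Iterated sums over total valuations

  Extensional : ((Name → Bool) → Carrier) → Set _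
  Extensional f = ∀ {σ τ} → σ ≗ τ → f σ ≈ f τ

  sum-++ : ∀ xs ys → sum (xs ++ ys) ≈ sum xs + sum ys
  sum-++ []       ys = ≈-sym (+-identityˡ _)
  sum-++ (x ∷ xs) ys = ≈-trans (+-congˡ (sum-++ xs ys)) (≈-sym (+-assoc _ _ _))

  -- Marginalisation one name at a time. The head name is assigned last, to match `override-cons`.
  sumOver : List Name → ((Name → Bool) → Carrier) → (Name → Bool) → Carrier
  sumOver []       f σ = f σ
  sumOver (X ∷ Xs) f σ =
    sumOver Xs (λ τ → f (τ [ X ≔ true ])) σ + sumOver Xs (λ τ → f (τ [ X ≔ false ])) σ

  sumOver-cong : ∀ Xs {f g} → (∀ σ → f σ ≈ g σ) → ∀ σ → sumOver Xs f σ ≈ sumOver Xs g σ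
  sumOver-cong []       e σ = e σ
  sumOver-cong (X ∷ Xs) e σ =
    +-cong (sumOver-cong Xs (λ τ → e (τ [ X ≔ true ])) σ)
           (sumOver-cong Xs (λ τ → e (τ [ X ≔ false ])) σ)

  sumOver-swap : ∀ X Y Xs {f} → Extensional f → ∀ σ →
                 sumOver (X ∷ Y ∷ Xs) f σ ≈ sumOver (Y ∷ X ∷ Xs) f σ
  sumOver-swap X Y Xs {f} ext σ with X ≟ Y
  -- Two assignments to the same name do not commute, but here both sides are the same expression.
  ... | yes ≡.refl = ≈-refl
  ... | no X≢Y     = ≈-trans (+.interchange _ _ _ _)
    (+-cong (+-cong (exchange true true) (exchange false true))
            (+-cong (exchange true false) (exchange false false)))
    where
    exchange : ∀ b c → sumOver Xs (λ τ → f (τ [ Y ≔ c ] [ X ≔ b ])) σ ≈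
                       sumOver Xs (λ τ → f (τ [ X ≔ b ] [ Y ≔ c ])) σ
    exchange b c = sumOver-cong Xs (λ τ → ext (assign-comm τ c b (X≢Y ∘ ≡.sym))) σ

  -- Assignments commute only pointwise, hence the extensionality of `f`.
  sumOver-↭ : ∀ {Xs Ys f} → Xs ↭ Ys → Extensional f → ∀ σ → sumOver Xs f σ ≈ sumOver Ys f σ
  sumOver-↭ refl         ext σ = ≈-refl
  sumOver-↭ (prep X p)   ext σ =
    +-cong (sumOver-↭ p (ext ∘ assign-cong X true) σ) (sumOver-↭ p (ext ∘ assign-cong X false) σ)
  sumOver-↭ {X ∷ Y ∷ Xs} {_ ∷ _ ∷ Ys} {f} (swap X Y p) ext σ =
    ≈-trans (sumOver-swap X Y Xs ext σ)
      (+-cong (+-cong (branch true true) (branch true false))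
              (+-cong (branch false true) (branch false false)))
    where
    branch : ∀ b c → sumOver Xs (λ τ → f (τ [ X ≔ c ] [ Y ≔ b ])) σ ≈
                     sumOver Ys (λ τ → f (τ [ X ≔ c ] [ Y ≔ b ])) σ
    branch b c = sumOver-↭ p (ext ∘ assign-cong Y b ∘ assign-cong X c) σ
  sumOver-↭ (trans p q)  ext σ = ≈-trans (sumOver-↭ p ext σ) (sumOver-↭ q ext σ)

  -- `valsOn` lists valuations according to the value at the head, so its sum splits into the same
  -- two branches as `sumOver`.
  sum-override : ∀ Xs {f} → Extensional f → ∀ σ →
                 sum (map (λ z̄ → f (override z̄ σ)) (valsOn Xs)) ≈ sumOver Xs f σ
  -- Overriding by the empty valuation computes to `σ`, which leaves only the final `0#`.
  sum-override []       ext σ = +-identityʳ _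
  sum-override (X ∷ Xs) {f} ext σ = begin
    sum (map F (map (cons true) z̄s ++ map (cons false) z̄s))
      ≡⟨ cong sum (map-++ F (map (cons true) z̄s) (map (cons false) z̄s)) ⟩
    sum (map F (map (cons true) z̄s) ++ map F (map (cons false) z̄s))
      ≈⟨ sum-++ (map F (map (cons true) z̄s)) _ ⟩
    sum (map F (map (cons true) z̄s)) + sum (map F (map (cons false) z̄s))
      ≈⟨ +-cong (branch true) (branch false) ⟩
    sumOver (X ∷ Xs) f σ ∎
    where
    z̄s : List (ValOn Xs)
    z̄s = valsOn Xs
    F : ValOn (X ∷ Xs) → Carrier
    F z̄ = f (override z̄ σ)
    branch : ∀ b → sum (map F (map (cons b) z̄s)) ≈ sumOver Xs (λ τ → f (τ [ X ≔ b ])) σ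
    branch b = begin
      sum (map F (map (cons b) z̄s))
        ≡⟨ cong sum (map-∘ z̄s) ⟨
      sum (map (F ∘ cons b) z̄s)
        ≈⟨ sum-map-cong _ _ (λ z̄ → ext (override-cons b z̄ σ)) z̄s ⟩
      sum (map (λ z̄ → f (override z̄ σ [ X ≔ b ])) z̄s)
        ≈⟨ sum-override Xs (ext ∘ assign-cong X b) σ ⟩
      sumOver Xs (λ τ → f (τ [ X ≔ b ])) σ ∎

  -- Factors evaluated at total valuations

  evalAt : Factor → (Name → Bool) → Carrier
  evalAt φ σ = evalᶠ φ (λ X _ → σ X)

  evalAt-ext : ∀ φ → Extensional (evalAt φ)
  evalAt-ext φ e = Factor.ext φ (λ X _ → e X)

  evalAt-totalise : ∀ φ x̄ → evalᶠ φ x̄ ≈ evalAt φ (totalise x̄)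
  evalAt-totalise φ x̄ = Factor.ext φ (totalise-∈ x̄)

  -- At a total valuation `glue` agrees with `override`, so the sum no longer depends on how `ℤ`
  -- sits inside `Nmᶠ φ`.
  evalAt-sumOut : ∀ ℤ φ .(i : ℤ ⊆ˢ Nmᶠ φ) σ →
                  evalAt (sumOut ℤ φ i) σ ≈ sumOver (elems ℤ) (evalAt φ) σ
  evalAt-sumOut ℤ φ i σ = begin
    sum (map (λ z̄ → evalᶠ φ (glue {Nmᶠ φ} {ℤ} z̄ (λ X _ → σ X))) (vals ℤ))
      ≈⟨ sum-map-cong _ _ (λ z̄ → Factor.ext φ (glue≐override z̄)) (vals ℤ) ⟩
    sum (map (λ z̄ → evalAt φ (override z̄ σ)) (vals ℤ))
      ≈⟨ sum-override (elems ℤ) (evalAt-ext φ) σ ⟩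
    sumOver (elems ℤ) (evalAt φ) σ ∎
    where
    glue≐override : ∀ (z̄ : Val ℤ) → glue {Nmᶠ φ} {ℤ} z̄ (λ X _ → σ X) ≐ (λ X _ → override z̄ σ X)
    glue≐override z̄ X p with X ∈? elems ℤ
    ... | yes _ = ≡.refl
    ... | no _  = ≡.refl

  -- `evalAt` turns `_⊙_` into `_*_` definitionally, because restricting a total valuation changes
  -- nothing; what remains is reordering a product in the ring.
  evalAt-⨀-↭ : ∀ {φs ψs} → φs ↭ ψs → ∀ σ → evalAt (⨀ φs) σ ≈ evalAt (⨀ ψs) σ
  evalAt-⨀-↭ refl         σ = ≈-refl
  evalAt-⨀-↭ (prep φ p)   σ = *-congˡ (evalAt-⨀-↭ p σ)
  evalAt-⨀-↭ (swap φ ψ p) σ =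
    ≈-trans (*-congˡ (*-congˡ (evalAt-⨀-↭ p σ))) (×.x∙yz≈y∙xz _ _ _)
  evalAt-⨀-↭ (trans p q)  σ = ≈-trans (evalAt-⨀-↭ p σ) (evalAt-⨀-↭ q σ)

  ∈-⨀⁺ : ∀ {X φs} → Any (λ φ → X ∈ˢ Nmᶠ φ) φs → X ∈ˢ Nmᶠ (⨀ φs)
  ∈-⨀⁺ {φs = φ ∷ φs} (here p)  = ∪-⁺ˡ (Nmᶠ φ) (Nmᶠ (⨀ φs)) p
  ∈-⨀⁺ {φs = φ ∷ φs} (there p) = ∪-⁺ʳ (Nmᶠ φ) (Nmᶠ (⨀ φs)) (∈-⨀⁺ p)

  ∈-⨀⁻ : ∀ {X} φs → X ∈ˢ Nmᶠ (⨀ φs) → Any (λ φ → X ∈ˢ Nmᶠ φ) φs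
  ∈-⨀⁻ (φ ∷ φs) p with ∪-⁻ (Nmᶠ φ) (Nmᶠ (⨀ φs)) p
  ... | inj₁ q = here q
  ... | inj₂ q = there (∈-⨀⁻ φs q)

  ⨀-↭-⊆ : ∀ {φs ψs} → φs ↭ ψs → Nmᶠ (⨀ φs) ⊆ˢ Nmᶠ (⨀ ψs)
  ⨀-↭-⊆ {φs} p q = ∈-⨀⁺ (Any-resp-↭ p (∈-⨀⁻ φs q))

  -- Both sides are compared at the one total valuation `totalise x̄`; there the summed names,
  -- duplicate-free on either side, may be permuted.
  sumOut-cong : ∀ φ ψ {ℤ ℤ′} .(i : ℤ ⊆ˢ Nmᶠ φ) .(i′ : ℤ′ ⊆ˢ Nmᶠ ψ) →
                ℤ ⊆ˢ ℤ′ → ℤ′ ⊆ˢ ℤ → Nmᶠ φ ⊆ˢ Nmᶠ ψ → Nmᶠ ψ ⊆ˢ Nmᶠ φ →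
                (∀ σ → evalAt φ σ ≈ evalAt ψ σ) → sumOut ℤ φ i ≋ sumOut ℤ′ ψ i′
  sumOut-cong φ ψ {ℤ} {ℤ′} i i′ ℤ⊆ ℤ⊇ φ⊆ ψ⊆ e = Nm⊆ , Nm⊇ , eval≈
    where
    Nm⊆ : (Nmᶠ φ ∖ ℤ) ⊆ˢ (Nmᶠ ψ ∖ ℤ′)
    Nm⊆ p = ∖-⁺ (Nmᶠ ψ) ℤ′ (φ⊆ (∖-⊆ (Nmᶠ φ) ℤ p)) (∖-∉ (Nmᶠ φ) ℤ p ∘ ℤ⊇)
    Nm⊇ : (Nmᶠ ψ ∖ ℤ′) ⊆ˢ (Nmᶠ φ ∖ ℤ)
    Nm⊇ p = ∖-⁺ (Nmᶠ φ) ℤ (ψ⊆ (∖-⊆ (Nmᶠ ψ) ℤ′ p)) (∖-∉ (Nmᶠ ψ) ℤ′ p ∘ ℤ⊆)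
    eval≈ : ∀ x̄ → evalᶠ (sumOut ℤ φ i) x̄ ≈
                  evalᶠ (sumOut ℤ′ ψ i′) (restrict {Nmᶠ φ ∖ ℤ} {Nmᶠ ψ ∖ ℤ′} Nm⊇ x̄)
    eval≈ x̄ = begin
      evalᶠ (sumOut ℤ φ i) x̄                      ≈⟨ evalAt-totalise (sumOut ℤ φ i) x̄ ⟩
      evalAt (sumOut ℤ φ i) (totalise x̄)          ≈⟨ evalAt-sumOut ℤ φ i (totalise x̄) ⟩
      sumOver (elems ℤ) (evalAt φ) (totalise x̄)   ≈⟨ sumOver-cong (elems ℤ) e (totalise x̄) ⟩
      sumOver (elems ℤ) (evalAt ψ) (totalise x̄)
        ≈⟨ sumOver-↭ (unique-↭ (unique ℤ) (unique ℤ′) ℤ⊆ ℤ⊇) (evalAt-ext ψ) (totalise x̄) ⟩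
      sumOver (elems ℤ′) (evalAt ψ) (totalise x̄)  ≈⟨ evalAt-sumOut ℤ′ ψ i′ (totalise x̄) ⟨
      evalAt (sumOut ℤ′ ψ i′) (totalise x̄)
        -- The restriction of `x̄` is matched with `totalise x̄` itself rather than with its own
        -- totalisation, so that both chains meet.
        ≈⟨ Factor.ext (sumOut ℤ′ ψ i′) (λ X p → totalise-∈ x̄ X (Nm⊇ p)) ⟨
      evalᶠ (sumOut ℤ′ ψ i′) (restrict {Nmᶠ φ ∖ ℤ} {Nmᶠ ψ ∖ ℤ′} Nm⊇ x̄) ∎

  -- Main names occur in the derivation

  main-∈-names  : ∀ {n} {Γ : Ctx n} {t A} (π : Γ ⊢ t ∶ A) {α} →
                  Any (α ≡_) (axioms π) → main α ∈ names π
  -- At an axiom `names⁻` is empty and the main name is the type of the subject, so `namesᵀ A` has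
  -- to be included. Together with realizability this makes the names of a closed ground derivation
  -- exactly its main names.
  main-∈-names⁻ : ∀ {n} {Γ : Ctx n} {t A} (π : Γ ⊢ t ∶ A) {α} →
                  Any (α ≡_) (axioms π) → main α ∈ namesᵀ A ++ names⁻ π
  main-∈-names-++ : ∀ {n m} {Γ : Ctx n} {Δ : Ctx m} {t u A B} (π : Γ ⊢ t ∶ A) (ρ : Δ ⊢ u ∶ B) {α} →
                  Any (α ≡_) (axioms π ++ axioms ρ) → main α ∈ names π ++ names ρ
  main-∈-names! : ∀ {n} {Γ : Ctx n} {t As} (πs : Γ ⊢! t ∶ As) {α} →
                  Any (α ≡_) (axioms! πs) → main α ∈ names! πs

  main-∈-names-++ π ρ α∈ with ∈-++⁻ (axioms π) α∈
  ... | inj₁ α∈₁ = ∈-++⁺ˡ (main-∈-names π α∈₁)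
  ... | inj₂ α∈₂ = ∈-++⁺ʳ (names π) (main-∈-names ρ α∈₂)

  main-∈-names {Γ = Γ} {A = A} π α∈ =
    subst (_ ∈_) (≡.sym (++-assoc (namesᶜ Γ) (namesᵀ A) (names⁻ π)))
      (∈-++⁺ʳ (namesᶜ Γ) (main-∈-names⁻ π α∈))

  main-∈-names⁻ (sample _ _)               (here ≡.refl) = here ≡.refl
  main-∈-names⁻ (cond _ _ _ _ _ _ _ _)     (here ≡.refl) = here ≡.refl
  main-∈-names⁻ {A = A} (let-in _ _ π₁ π₂) α∈ = ∈-++⁺ʳ (namesᵀ A) (main-∈-names-++ π₁ π₂ α∈)
  main-∈-names⁻ {A = A} (pair _ π₁ π₂)     α∈ = ∈-++⁺ʳ (namesᵀ A) (main-∈-names-++ π₁ π₂ α∈)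
  main-∈-names⁻ {A = A} (letp-in π₁ π₂)    α∈ = ∈-++⁺ʳ (namesᵀ A) (main-∈-names-++ π₁ π₂ α∈)
  main-∈-names⁻ {A = A} (app _ _ π₁ π₂)    α∈ = ∈-++⁺ʳ (namesᵀ A) (main-∈-names-++ π₁ π₂ α∈)
  main-∈-names⁻ {A = A} (abs π)            α∈ = ∈-++⁺ʳ (namesᵀ A) (main-∈-names π α∈)
  main-∈-names⁻ {A = A} (der π)            α∈ = ∈-++⁺ʳ (namesᵀ A) (main-∈-names π α∈)
  main-∈-names⁻ {A = A} (bang πs)          α∈ = ∈-++⁺ʳ (namesᵀ A) (main-∈-names! πs α∈)

  main-∈-names! (add _ π πs) α∈ with ∈-++⁻ (axioms π) α∈
  ... | inj₁ α∈₁ = ∈-++⁺ˡ (main-∈-names π α∈₁)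
  ... | inj₂ α∈₂ = ∈-++⁺ʳ (names π) (main-∈-names! πs α∈₂)

  -- The components of the derivation against the tables of the network

  module _ {t L} (π : Derivation ∙ t (pos (ground L))) where

    open Extraction π using (αs; axiom; table; Nm-⊆; edge-∈)

    αsByName : List Axiom
    αsByName = mapWith∈ (elems (Nm π)) (proj₁ ∘ axiom)

    -- Transfers the absence of duplicates from `elems (Nm π)` to `αsByName`.
    main-αsByName : map main αsByName ≡ elems (Nm π)
    main-αsByName = ≡.trans (map-mapWith∈ (elems (Nm π)) (proj₁ ∘ axiom) main)
      (≡.trans (mapWith∈-cong (elems (Nm π)) _ _ (λ p → ≡.sym (proj₂ (proj₂ (axiom p)))))
               (mapWith∈-id (elems (Nm π))))

    αs↭αsByName : αs ↭ αsByName
    αs↭αsByName = unique-↭ (Unique.map⁻ (naming π))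
      (Unique.map⁻ (subst Unique (≡.sym main-αsByName) (unique (Nm π)))) to from
      where
      to : ∀ {α} → Any (α ≡_) αs → Any (α ≡_) αsByName
      -- The axiom that `axiom` selects for `main α` could a priori differ from `α`; the naming
      -- condition identifies the two.
      to {α} α∈ = mapWith∈⁺ (proj₁ ∘ axiom) (main α , p , unique-map main (naming π) α∈ α′∈ m)
        where
        p : main α ∈ˢ Nm π
        p = ∈-fromList⁺ (main-∈-names (tree π) α∈)
        α′∈ = proj₁ (proj₂ (axiom p))
        m   = proj₂ (proj₂ (axiom p))
      from : ∀ {α} → Any (α ≡_) αsByName → Any (α ≡_) αs
      from α∈ with mapWith∈⁻ (elems (Nm π)) (proj₁ ∘ axiom) α∈
      ... | _ , p , ≡.refl = proj₁ (proj₂ (axiom p))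

    Cpts↭tables : Cpts π ↭ mapWith∈ (elems (Nm π)) table
    Cpts↭tables = ↭-trans (map⁺ factor αs↭αsByName)
      (↭-reflexive (map-mapWith∈ (elems (Nm π)) (proj₁ ∘ axiom) factor))

    -- A name in the table at `X` is `X` or a parent of `X`, and a parent is the source of an edge,
    -- hence a name of `π`.
    Nm-⟦⟧ᴮ-⊆ : Nmᶠ ⟦ 𝓑 π ⟧ᴮ ⊆ˢ Nm π
    Nm-⟦⟧ᴮ-⊆ q with mapWith∈⁻ (elems (Nm π)) table (∈-⨀⁻ (mapWith∈ (elems (Nm π)) table) q)
    ... | X , p , r with Nm-⊆ p r
    ...   | inj₁ ≡.refl = p
    ...   | inj₂ Y⟶X    = proj₁ (edge-∈ Y⟶X)

    ⟦⟧≋marginal : ⟦ π ⟧ ≋ sumOut (Nm π ∖ Nmᴳ L) ⟦ 𝓑 π ⟧ᴮ (marginal-⊆ π)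
    -- As the context is empty, `Nmᴶ ∙ (pos (ground L))` computes to `Nmᴳ L`. The two sets summed
    -- out then agree because `Φ`, the network and `π` have the same names.
    ⟦⟧≋marginal = sumOut-cong Φ ⟦ 𝓑 π ⟧ᴮ (∖-⊆ (Nmᶠ Φ) (Nmᴳ L)) (marginal-⊆ π)
      (∖-monoˡ (Nmᶠ Φ) (Nm π) (Nmᴳ L) (Nm-⟦⟧ᴮ-⊆ ∘ Φ⊆))
      (∖-monoˡ (Nm π) (Nmᶠ Φ) (Nmᴳ L) (Φ⊇ ∘ ⟦⟧ᴮ-⊇ (𝓑 π)))
      Φ⊆ Φ⊇ (evalAt-⨀-↭ Cpts↭tables)
      where
      Φ : Factor
      Φ = ⨀ (Cpts π)
      Φ⊆ : Nmᶠ Φ ⊆ˢ Nmᶠ ⟦ 𝓑 π ⟧ᴮ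
      Φ⊆ = ⨀-↭-⊆ Cpts↭tables
      Φ⊇ : Nmᶠ ⟦ 𝓑 π ⟧ᴮ ⊆ˢ Nmᶠ Φ
      Φ⊇ = ⨀-↭-⊆ (↭-sym Cpts↭tables)

theorem7p1 : ∀ {c ℓ₁ ℓ₂} (ℝ : OrderedCommutativeRing c ℓ₁ ℓ₂) →
    let open Calculus ℝ in
    ∀ (t : Term 0) (L : Ground) (π : Derivation ∙ t (pos (ground L))) →
    ⟦ π ⟧ ≋ sumOut (Nm π ∖ Nmᴳ L) ⟦ 𝓑 π ⟧ᴮ (marginal-⊆ π)
theorem7p1 ℝ t L π = ⟦⟧≋marginal ℝ π
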